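{- If the OWA weights are nonincreasing, i.e. $w_1\ge w_2\ge\dots\ge w_K$, and $\mathcal{P}$ is polynomially solvable, then $\textsc{Min-Owa}~\mathcal{P}$ is approximable within $w_1K$, where $K$ is the number of scenarios.
   Context: A combinatorial optimization problem $\mathcal{P}$: each instance specifies a finite set of elements $E=\{e_1,\dots,e_n\}$, a set of feasible solutions $\Phi\subseteq 2^E$ (typically described implicitly), and a nonnegative cost $c_i$ for each $e_i\in E$; one seeks $X\in\Phi$ minimizing $\sum_{e_i\in X}c_i$. $\mathcal{P}$ is polynomially solvable if an optimal solution can be computed in polynomial time for all nonnegative costs. Uncertain version: instead of a single cost vector one is given a scenario set $\Gamma=\{\pmb{c}_1,\dots,\pmb{c}_K\}$ of $K$ distinct cost scenarios $\pmb{c}_j=(c_{1j},\dots,c_{nj})$ with nonnegative entries ($K$ may be part of the input), and $F(X,\pmb{c}_j)=\sum_{e_i\in X}c_{ij}$. For a weight vector $\pmb{w}=(w_1,\dots,w_K)$ with $w_j\in[0,1]$ and $\sum_j w_j=1$, let $$\mathrm{OWA}(X)=\sum_{j=1}^K w_jF(X,\pmb{c}_{\sigma(j)}),$$ where $\sigma$ is a permutation of $\{1,\dots,K\}$ with $F(X,\pmb{c}_{\sigma(1)})\ge\dots\ge F(X,\pmb{c}_{\sigma(K)})$. $\textsc{Min-Owa}~\mathcal{P}$ is the problem $\min_{X\in\Phi}\mathrm{OWA}(X)$. A minimization problem is approximable within $\rho$ if there is a polynomial-time algorithm that on each instance returns a feasible solution whose objective value is at most $\rho$ times the optimal value.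
   Formalization: The scenario costs and the OWA weights are taken to be rational numbers, given in binary as part of the input, instead of arbitrary nonnegative real costs and real weights in [0,1]. -}

module Defs where

open import Data.Bool.Base using (Bool; true; false; if_then_else_)
open import Data.Fin.Base as Fin using (Fin; zero; suc)
open import Data.Fin.Permutation using (Permutation′; _⟨$⟩ʳ_; insert; id)
open import Data.Fin.Subset using (Subset)
open import Data.Integer.Base as ℤ using (ℤ; -[1+_])
open import Data.List.Base using (List; []; _∷_)
open import Data.Nat.Base as ℕ using (ℕ; zero; suc)
open import Data.Nat.Binary.Base using (ℕᵇ; zero; 2[1+_]; 1+[2_]; fromℕ)
open import Data.Product.Base using (Σ; ∃-syntax; _×_; _,_; proj₁; proj₂)
open import Data.Rational.Base using (ℚ; 0ℚ; 1ℚ; ↥_; ↧ₙ_; _*_; _≤_; _≥_; _/_)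
open import Data.Rational.Properties
  using (≤-refl; ≤-trans; ≤-total; +-0-commutativeMonoid)
open import Algebra.Properties.CommutativeMonoid.Sum +-0-commutativeMonoid
  using () renaming (sum to ∑)
open import Data.Sum.Base using (inj₁; inj₂)
open import Data.Vec.Base using (lookup)
open import Data.Vec.Functional using (Vector; toList; head; tail; map; removeAt; rearrange)
open import Function.Base using (_∘_)
open import Function.Definitions using (Injective)
open import Level using (0ℓ)
open import Relation.Binary.Core using (_Preserves_⟶_)
open import Relation.Binary.PropositionalEquality.Core using (_≡_; _≢_; _≗_)
open import Relation.Unary using (Pred; _∈_)

infixr 5 _∙_
infixl 4 _⨾_
infix  3 _⊢_⇓_⟨_⟩

------------------------------------------------------------------------
-- Model of computation
--
-- A variable-free form of Jones's WHILE language: the store is one binary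
-- tree.  Every operation is charged the size of the tree it acts on, so a
-- result is never larger than the time spent on it, and time is
-- polynomially related to Turing machine time.

data Tree : Set where
  nil : Tree
  _∙_ : Tree → Tree → Tree

size : Tree → ℕ
size nil     = 1
size (a ∙ b) = suc (size a ℕ.+ size b)

hd tl : Tree → Tree
hd nil     = nil
hd (a ∙ b) = a
tl nil     = nil
tl (a ∙ b) = b

-- Tests and loop guards inspect the head of the store: nil is "false",
-- anything else is "true".

data Program : Set where
  skip clear left right : Program
  _⨾_                   : Program → Program → Program
  ⟪_,_⟫                 : Program → Program → Program
  ifhd_else_            : Program → Program → Program
  while                 : Program → Program

private variable
  p q         : Program
  x y z       : Tree
  t u n       : ℕ

-- p ⊢ x ⇓ y ⟨ t ⟩ : started on x, p halts with y after time t.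

data _⊢_⇓_⟨_⟩ : Program → Tree → Tree → ℕ → Set where
  ⇓skip  : skip  ⊢ x ⇓ x    ⟨ size x ⟩
  ⇓clear : clear ⊢ x ⇓ nil  ⟨ size x ⟩
  ⇓left  : left  ⊢ x ⇓ hd x ⟨ size x ⟩
  ⇓right : right ⊢ x ⇓ tl x ⟨ size x ⟩
  ⇓seq   : p ⊢ x ⇓ y ⟨ t ⟩ → q ⊢ y ⇓ z ⟨ u ⟩ →
           p ⨾ q ⊢ x ⇓ z ⟨ t ℕ.+ u ⟩
  ⇓pair  : p ⊢ x ⇓ y ⟨ t ⟩ → q ⊢ x ⇓ z ⟨ u ⟩ →
           ⟪ p , q ⟫ ⊢ x ⇓ y ∙ z ⟨ size x ℕ.+ t ℕ.+ u ⟩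
  ⇓then  : hd x ≢ nil → p ⊢ x ⇓ y ⟨ t ⟩ →
           ifhd p else q ⊢ x ⇓ y ⟨ size x ℕ.+ t ⟩
  ⇓else  : hd x ≡ nil → q ⊢ x ⇓ y ⟨ t ⟩ →
           ifhd p else q ⊢ x ⇓ y ⟨ size x ℕ.+ t ⟩
  ⇓stop  : hd x ≡ nil → while p ⊢ x ⇓ x ⟨ size x ⟩
  ⇓loop  : hd x ≢ nil → p ⊢ x ⇓ y ⟨ t ⟩ → while p ⊢ y ⇓ z ⟨ u ⟩ →
           while p ⊢ x ⇓ z ⟨ size x ℕ.+ t ℕ.+ u ⟩

------------------------------------------------------------------------
-- Encodings

encodeList : List Tree → Tree
encodeList []       = nil
encodeList (x ∷ xs) = x ∙ encodeList xs

encodeVector : {A : Set} → (A → Tree) → Vector A n → Tree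
encodeVector encode = encodeList ∘ toList ∘ map encode

encodeBool : Bool → Tree
encodeBool false = nil
encodeBool true  = nil ∙ nil

-- Binary notation with the digits 1 and 2, least significant digit first;
-- the size of the code of m is of order log m.
encodeℕᵇ : ℕᵇ → Tree
encodeℕᵇ zero     = nil
encodeℕᵇ 1+[2 m ] = nil ∙ encodeℕᵇ m
encodeℕᵇ 2[1+ m ] = (nil ∙ nil) ∙ encodeℕᵇ m

encodeℕ : ℕ → Tree
encodeℕ = encodeℕᵇ ∘ fromℕ

encodeℤ : ℤ → Tree
encodeℤ (ℤ.+ m)    = nil ∙ encodeℕ m
encodeℤ (-[1+ m ]) = (nil ∙ nil) ∙ encodeℕ m

encodeℚ : ℚ → Tree
encodeℚ r = encodeℤ (↥ r) ∙ encodeℕ (↧ₙ r)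

encodeSubset : Subset n → Tree
encodeSubset X = encodeVector encodeBool (lookup X)

------------------------------------------------------------------------
-- Minimization over subsets of a finite set, and polynomial time

record Minimization : Set₁ where
  field
    Instance  : Set
    encode    : Instance → Tree
    ∣_∣ᴱ      : Instance → ℕ
    Feasible  : (I : Instance) → Pred (Subset ∣ I ∣ᴱ) 0ℓ
    objective : (I : Instance) → Subset ∣ I ∣ᴱ → ℚ

  Optimal : (I : Instance) → Pred (Subset ∣ I ∣ᴱ) 0ℓ
  Optimal I X = X ∈ Feasible I ×
                (∀ Y → Y ∈ Feasible I → objective I X ≤ objective I Y)

  -- One program outputs, on every instance I, some X ∈ Good I, in time
  -- polynomial in the size of the encoded instance.
  PolynomialTime : ((I : Instance) → Pred (Subset ∣ I ∣ᴱ) 0ℓ) → Set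
  PolynomialTime Good =
    ∃[ p ] ∃[ c ] ∃[ k ] ∀ I →
    ∃[ X ] X ∈ Good I ×
    ∃[ t ] p ⊢ encode I ⇓ encodeSubset X ⟨ t ⟩ ×
           t ℕ.≤ c ℕ.* size (encode I) ℕ.^ k ℕ.+ c

  PolynomiallySolvable : Set
  PolynomiallySolvable = PolynomialTime Optimal

  WithinFactor : (Instance → ℚ) → (I : Instance) → Pred (Subset ∣ I ∣ᴱ) 0ℓ
  WithinFactor ρ I X = X ∈ Feasible I ×
    (∀ Y → Y ∈ Optimal I → objective I X ≤ ρ I * objective I Y)

  ApproximableWithin : (Instance → ℚ) → Set
  ApproximableWithin ρ = PolynomialTime (WithinFactor ρ)

-- The same problem with only the instances satisfying C as inputs.
restrict : (Q : Minimization) → Pred (Minimization.Instance Q) 0ℓ → Minimization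
restrict Q C = record
  { Instance  = Σ Instance C
  ; encode    = encode ∘ proj₁
  ; ∣_∣ᴱ      = ∣_∣ᴱ ∘ proj₁
  ; Feasible  = λ (I , _) → Feasible I
  ; objective = λ (I , _) → objective I
  } where open Minimization Q

------------------------------------------------------------------------
-- Combinatorial optimization problems

-- The ground set and the feasible sets are given implicitly by a finite
-- description; the costs are separate.
record CombinatorialProblem : Set₁ where
  field
    Description      : Set
    encode           : Description → Tree
    encode-injective : Injective _≡_ _≡_ encode
    ∣_∣ᴱ             : Description → ℕ
    Φ                : (D : Description) → Pred (Subset ∣ D ∣ᴱ) 0ℓ

F : Subset n → Vector ℚ n → ℚ
F X c = ∑ λ i → if lookup X i then c i else 0ℚ

NonNegative : Pred (Vector ℚ n) 0ℓ
NonNegative c = ∀ i → 0ℚ ≤ c i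

module _ (P : CombinatorialProblem) where
  open CombinatorialProblem P

  record CostInstance : Set where
    field
      description : Description
      cost        : Vector ℚ ∣ description ∣ᴱ
      cost≥0      : NonNegative cost

  Min : Minimization
  Min = record
    { Instance  = CostInstance
    ; encode    = λ I → encode (description I) ∙ encodeVector encodeℚ (cost I)
    ; ∣_∣ᴱ      = λ I → ∣ description I ∣ᴱ
    ; Feasible  = λ I → Φ (description I)
    ; objective = λ I X → F X (cost I)
    } where open CostInstance

------------------------------------------------------------------------
-- The OWA criterion

Nonincreasing : Pred (Vector ℚ n) 0ℓ
Nonincreasing f = f Preserves Fin._≤_ ⟶ _≥_

argmax : (f : Vector ℚ (suc n)) → ∃[ i ] ∀ j → f j ≤ f i
argmax {zero}  f = zero , λ { zero → ≤-refl }
argmax {suc n} f with argmax (tail f)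
... | i , max with ≤-total (f zero) (f (suc i))
...   | inj₁ le = suc i , λ { zero → le ; (suc j) → max j }
...   | inj₂ ge = zero  , λ { zero → ≤-refl ; (suc j) → ≤-trans (max j) ge }

-- The permutation σ of the definition of OWA.  Ties may be broken in any
-- way without changing the value of OWA.
sortingPermutation : (f : Vector ℚ n) →
                     Σ (Permutation′ n) λ σ → Nonincreasing (rearrange (σ ⟨$⟩ʳ_) f)
sortingPermutation {zero}  f = id , λ { {()} }
sortingPermutation {suc n} f with argmax f
... | i , max with sortingPermutation (removeAt f i)
...   | σ , sorted = insert zero i σ , λ
  { {zero}  {zero}  _           → ≤-refl
  ; {zero}  {suc k} _           → max _
  ; {suc j} {suc k} (ℕ.s≤s j≤k) → sorted j≤k
  }

module _ {n K : ℕ} (w : Vector ℚ K) (Γ : Vector (Vector ℚ n) K) where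

  OWA : Subset n → ℚ
  OWA X = ∑ λ j → w j * F X (Γ (σ ⟨$⟩ʳ j))
    where
    σ : Permutation′ K
    σ = proj₁ (sortingPermutation λ j → F X (Γ j))

module _ (P : CombinatorialProblem) where
  open CombinatorialProblem P

  -- There is at least one scenario since the weights sum to 1.
  record OwaInstance : Set where
    field
      description : Description
      K-1         : ℕ

    K : ℕ
    K = suc K-1

    field
      Γ          : Vector (Vector ℚ ∣ description ∣ᴱ) K
      Γ≥0        : ∀ j → NonNegative (Γ j)
      Γ-distinct : Injective _≡_ _≗_ Γ
      w          : Vector ℚ K
      w≥0        : ∀ j → 0ℚ ≤ w j
      w≤1        : ∀ j → w j ≤ 1ℚ
      ∑w≡1       : ∑ w ≡ 1ℚ

    w₁ : ℚ
    w₁ = head w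

    Kℚ : ℚ
    Kℚ = ℤ.+ K / 1

  open OwaInstance

  MinOwa : Minimization
  MinOwa = record
    { Instance  = OwaInstance
    ; encode    = λ I → encode (description I)
                      ∙ encodeVector (encodeVector encodeℚ) (Γ I)
                      ∙ encodeVector encodeℚ (w I)
    ; ∣_∣ᴱ      = λ I → ∣ description I ∣ᴱ
    ; Feasible  = λ I → Φ (description I)
    ; objective = λ I → OWA (w I) (Γ I)
    }

  NonincreasingWeights : Pred OwaInstance 0ℓ
  NonincreasingWeights I = Nonincreasing (w I)

{-# OPTIONS --safe #-}
module Submission where

open import Defs
open import Algebra.Bundles using (CommutativeRing)
open import Data.Bool.Base using (true; false; if_then_else_)
open import Data.Fin.Base using (Fin; zero; suc; toℕ; fromℕ<)
open import Data.Fin.Permutation using (_⟨$⟩ʳ_)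
open import Data.Fin.Properties using (toℕ<n; toℕ-fromℕ<)
open import Data.Fin.Subset using (Subset)
import Data.Integer.Base as ℤ
import Data.Integer.Properties as ℤ
open import Data.List.Base as List using (List; []; _∷_; _++_; foldl; length; reverse; _ʳ++_; tabulate)
import Data.List.Properties as List
open import Data.List.Relation.Binary.Pointwise.Base using (Pointwise; []; _∷_)
import Data.List.Relation.Binary.Pointwise as Pointwise
open import Data.List.Relation.Unary.All as All using (All; []; _∷_)
import Data.List.Relation.Unary.All.Properties as All
open import Data.Nat.Base using (ℕ; zero; suc; _+_; _*_; _^_; _≤_; _<_; z≤n; s≤s; s≤s⁻¹; >-nonZero)
open import Data.Nat.Binary.Base as Bin using (ℕᵇ; 2[1+_]; 1+[2_])
open import Data.Nat.Binary.Properties using (toℕ-fromℕ; fromℕ-toℕ)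
import Data.Nat.Coprimality as Coprimality
open import Data.Nat.DivMod using (_/_; _%_; m≡m%n+[m/n]*n; m%n<n; m<n*o⇒m/o<n)
open import Data.Nat.Properties
open import Data.Nat.Tactic.RingSolver using (solve-∀)
open import Data.Product.Base using (∃-syntax; _×_; _,_; proj₁; proj₂)
open import Data.Rational.Base as ℚ using (ℚ; 0ℚ; 1ℚ; mkℚ; ↥_; ↧ₙ_)
import Data.Rational.Properties as ℚ
open import Data.Rational.Solver using (module +-*-Solver)
import Data.Rational.Unnormalised.Base as ℚᵘ
import Data.Rational.Unnormalised.Properties as ℚᵘ
open import Data.Sum.Base using (_⊎_; inj₁; inj₂)
open import Data.Unit.Base using (⊤; tt)
open import Data.Vec.Base using (lookup)
open import Data.Vec.Functional using (Vector; head; tail)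
open import Function.Base using (_∘_; id)
open import Relation.Binary.PropositionalEquality
open import Algebra.Properties.CommutativeMonoid.Sum ℚ.+-0-commutativeMonoid
  using (sum-cong-≗; sum-replicate-zero; ∑-comm; sum-permute) renaming (sum to ∑)
open import Algebra.Properties.Semiring.Sum (CommutativeRing.semiring ℚ.+-*-commutativeRing)
  using (*-distribˡ-sum; *-distribʳ-sum)
open +-*-Solver using (solve; _:=_; _:+_; _:*_; _:-_) renaming (con to :con)

-- Let T(X) be the sum of F(X, c_j) over all scenarios.  For nonincreasing
-- weights OWA(X) ≤ w₁ T(X), since no weight exceeds w₁, while Chebyshev's
-- sum inequality gives T(Y) ≤ K OWA(Y).  Hence a minimizer of T is within
-- w₁ K of every solution, and T is a linear objective, whose element costs
-- are the sums over the scenarios.  Multiplying these costs by a common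
-- denominator makes them natural numbers, so that the polynomial-time
-- program computing them only adds and multiplies: no fraction has to be
-- reduced.

-- Polynomial-time computable functions

-- The main obstacle is the machine model, not the inequality. A rational is encoded in lowest
-- terms, so summing costs directly would call for a gcd program; a natural number `n`, however, has
-- the code of the pair `(n , 1)`, and a common positive factor does not change which solutions are
-- minimal. Another danger is iteration: a polynomial-time step may square its state, and repeating
-- it then leaves polynomial time. Such bounds come from bit lengths: a product has at most as many
-- bits as its factors together, so even the product of all denominators has a bit length linear in
-- the input size. Programs are assembled from combinators that carry their time bounds, and types
-- whose elements have the same trees are interchangeable.

data Polynomial : Set where
  var         : Polynomial
  con         : ℕ → Polynomial
  _⊕_ _⊛_ _∘ₚ_ : Polynomial → Polynomial → Polynomial

infixl 6 _⊕_
infixl 7 _⊛_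
infixr 9 _∘ₚ_

⟦_⟧ : Polynomial → ℕ → ℕ
⟦ var ⟧    n = n
⟦ con c ⟧  n = c
⟦ p ⊕ q ⟧  n = ⟦ p ⟧ n + ⟦ q ⟧ n
⟦ p ⊛ q ⟧  n = ⟦ p ⟧ n * ⟦ q ⟧ n
⟦ p ∘ₚ q ⟧ n = ⟦ p ⟧ (⟦ q ⟧ n)

-- Natural coefficients make every expression monotone. The size of an intermediate result may
-- therefore be replaced by a bound for it, and exponents are computed only once, at the very end.
⟦⟧-mono : ∀ p {m n} → m ≤ n → ⟦ p ⟧ m ≤ ⟦ p ⟧ n
⟦⟧-mono var      m≤n = m≤n
⟦⟧-mono (con c)  m≤n = ≤-refl
⟦⟧-mono (p ⊕ q)  m≤n = +-mono-≤ (⟦⟧-mono p m≤n) (⟦⟧-mono q m≤n)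
⟦⟧-mono (p ⊛ q)  m≤n = *-mono-≤ (⟦⟧-mono p m≤n) (⟦⟧-mono q m≤n)
⟦⟧-mono (p ∘ₚ q) m≤n = ⟦⟧-mono p (⟦⟧-mono q m≤n)

monomial : ℕ → ℕ → Polynomial
monomial c zero    = con c
monomial c (suc k) = var ⊛ monomial c k

⟦monomial⟧ : ∀ c k n → ⟦ monomial c k ⟧ n ≡ c * n ^ k
⟦monomial⟧ c zero    n = sym (*-identityʳ c)
⟦monomial⟧ c (suc k) n = trans (cong (n *_) (⟦monomial⟧ c k n)) (swap n c (n ^ k))
  where
  swap : ∀ a b c → a * (b * c) ≡ b * (a * c)
  swap = solve-∀

^-distribʳ-* : ∀ a b k → (a * b) ^ k ≡ a ^ k * b ^ k
^-distribʳ-* a b zero    = refl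
^-distribʳ-* a b (suc k) = trans (cong (a * b *_) (^-distribʳ-* a b k)) (swap a b (a ^ k) (b ^ k))
  where
  swap : ∀ a b x y → a * b * (x * y) ≡ a * x * (b * y)
  swap = solve-∀

-- Bounding by powers of suc n rather than n keeps the base positive in
-- the case of a composition.
⟦⟧≤power : ∀ p → ∃[ c ] ∃[ k ] ∀ n → ⟦ p ⟧ n ≤ c * suc n ^ k
⟦⟧≤power var = 1 , 1 , λ n → ≤-trans (n≤1+n n)
  (≤-reflexive (sym (trans (*-identityˡ (suc n ^ 1)) (*-identityʳ (suc n)))))
⟦⟧≤power (con c) = c , 0 , λ n → ≤-reflexive (sym (*-identityʳ c))
⟦⟧≤power (p ⊕ q) with ⟦⟧≤power p | ⟦⟧≤power q
... | c , k , p≤ | d , l , q≤ = c + d , k + l , λ n → begin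
  ⟦ p ⟧ n + ⟦ q ⟧ n                           ≤⟨ +-mono-≤ (p≤ n) (q≤ n) ⟩
  c * suc n ^ k + d * suc n ^ l               ≤⟨ +-mono-≤ (*-monoʳ-≤ c (^-monoʳ-≤ (suc n) (m≤m+n k l)))
                                                          (*-monoʳ-≤ d (^-monoʳ-≤ (suc n) (m≤n+m l k))) ⟩
  c * suc n ^ (k + l) + d * suc n ^ (k + l)   ≡⟨ *-distribʳ-+ (suc n ^ (k + l)) c d ⟨
  (c + d) * suc n ^ (k + l)                   ∎
  where open ≤-Reasoning
⟦⟧≤power (p ⊛ q) with ⟦⟧≤power p | ⟦⟧≤power q
... | c , k , p≤ | d , l , q≤ = c * d , k + l , λ n → begin
  ⟦ p ⟧ n * ⟦ q ⟧ n                       ≤⟨ *-mono-≤ (p≤ n) (q≤ n) ⟩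
  c * suc n ^ k * (d * suc n ^ l)         ≡⟨ swap c (suc n ^ k) d (suc n ^ l) ⟩
  c * d * (suc n ^ k * suc n ^ l)         ≡⟨ cong (c * d *_) (^-distribˡ-+-* (suc n) k l) ⟨
  c * d * suc n ^ (k + l)                 ∎
  where
  open ≤-Reasoning
  swap : ∀ a b x y → a * b * (x * y) ≡ a * x * (b * y)
  swap = solve-∀
⟦⟧≤power (p ∘ₚ q) with ⟦⟧≤power p | ⟦⟧≤power q
... | c , k , p≤ | d , l , q≤ = c * suc d ^ k , l * k , λ n → begin
  ⟦ p ⟧ (⟦ q ⟧ n)                       ≤⟨ p≤ (⟦ q ⟧ n) ⟩
  c * suc (⟦ q ⟧ n) ^ k                 ≤⟨ *-monoʳ-≤ c (^-monoˡ-≤ k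
                                             (+-mono-≤ (m^n>0 (suc n) l) (q≤ n))) ⟩
  c * (suc d * suc n ^ l) ^ k           ≡⟨ cong (c *_) (^-distribʳ-* (suc d) (suc n ^ l) k) ⟩
  c * (suc d ^ k * (suc n ^ l) ^ k)     ≡⟨ cong (λ e → c * (suc d ^ k * e)) (^-*-assoc (suc n) l k) ⟩
  c * (suc d ^ k * suc n ^ (l * k))     ≡⟨ *-assoc c _ _ ⟨
  c * suc d ^ k * suc n ^ (l * k)       ∎
  where open ≤-Reasoning

1≤size : ∀ x → 1 ≤ size x
1≤size nil     = ≤-refl
1≤size (x ∙ y) = s≤s z≤n

size-hd : ∀ x → size (hd x) ≤ size x
size-hd nil     = ≤-refl
size-hd (x ∙ y) = m≤n⇒m≤1+n (m≤m+n _ _)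

size-tl : ∀ x → size (tl x) ≤ size x
size-tl nil     = ≤-refl
size-tl (x ∙ y) = m≤n⇒m≤1+n (m≤n+m _ _)

-- Every operation is charged for the store it acts on; for a pair this charge, at least 1, pays for
-- the new node. Time bounds thus double as size bounds, as composition requires.
result≤time : ∀ {p x y t} → p ⊢ x ⇓ y ⟨ t ⟩ → size y ≤ t
result≤time ⇓skip           = ≤-refl
result≤time {x = x} ⇓clear  = 1≤size x
result≤time {x = x} ⇓left   = size-hd x
result≤time {x = x} ⇓right  = size-tl x
result≤time (⇓seq d e)      = ≤-trans (result≤time e) (m≤n+m _ _)
result≤time {x = x} (⇓pair {t = t} {u = u} d e) =
  +-mono-≤ (≤-trans (+-mono-≤ (1≤size x) (result≤time d)) ≤-refl) (result≤time e)
result≤time (⇓then _ d)     = ≤-trans (result≤time d) (m≤n+m _ _)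
result≤time (⇓else _ d)     = ≤-trans (result≤time d) (m≤n+m _ _)
result≤time (⇓stop _)       = ≤-refl
result≤time (⇓loop _ d e)   = ≤-trans (result≤time e) (m≤n+m _ _)

-- Combinators for computable functions

record Code : Set₁ where
  constructor code
  field
    Carrier : Set
    ⌜_⌝     : Carrier → Tree

  ∣_∣ : Carrier → ℕ
  ∣ x ∣ = size ⌜ x ⌝

open Code using (Carrier)

private variable
  A B C S     : Code
  a b k l m n : ℕ

infixr 2 _⊗_

_⊗_ : Code → Code → Code
A ⊗ B = code (Carrier A × Carrier B) λ (a , b) → Code.⌜ A ⌝ a ∙ Code.⌜ B ⌝ b

ListCode : Code → Code
ListCode A = code (List (Carrier A)) (encodeList ∘ List.map Code.⌜ A ⌝)

record Computable (A B : Code) (f : Carrier A → Carrier B) : Set where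
  open Code
  field
    program : Program
    bound   : Polynomial
    halts   : ∀ x → ∃[ t ] program ⊢ ⌜ A ⌝ x ⇓ ⌜ B ⌝ (f x) ⟨ t ⟩ × t ≤ ⟦ bound ⟧ (∣ A ∣ x)

  result≤bound : ∀ x → ∣ B ∣ (f x) ≤ ⟦ bound ⟧ (∣ A ∣ x)
  result≤bound x with halts x
  ... | t , run , t≤ = ≤-trans (result≤time run) t≤

open Computable

-- Different types may use the same trees: a nonempty list and the pair of its head and tail, a
-- number and its numeral, a fraction and a pair with a trivial sign. Passing between them costs one
-- `skip`.
coerce : {f : Carrier A → Carrier B} →
         (∀ x → Code.⌜ B ⌝ (f x) ≡ Code.⌜ A ⌝ x) → Computable A B f
coerce same .program = skip
coerce same .bound   = var
coerce same .halts x rewrite same x = _ , ⇓skip , ≤-refl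

cast : {f g : Carrier A → Carrier B} → (∀ x → f x ≡ g x) → Computable A B f → Computable A B g
cast f≗g c .program = program c
cast f≗g c .bound   = bound c
cast f≗g c .halts x rewrite sym (f≗g x) = halts c x

identity : Computable A A id
identity = coerce λ _ → refl

infixr 9 _∘ᶜ_

_∘ᶜ_ : {g : Carrier B → Carrier C} {f : Carrier A → Carrier B} →
       Computable B C g → Computable A B f → Computable A C (g ∘ f)
(d ∘ᶜ c) .program = program c ⨾ program d
(d ∘ᶜ c) .bound   = bound c ⊕ bound d ∘ₚ bound c
_∘ᶜ_ {f = f} d c .halts x with halts c x | halts d (f x)
... | t , run , t≤ | u , run′ , u≤ = t + u , ⇓seq run run′ ,
  +-mono-≤ t≤ (≤-trans u≤ (⟦⟧-mono (bound d) (result≤bound c x)))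

⟨_,_⟩ : {f : Carrier A → Carrier B} {g : Carrier A → Carrier C} →
        Computable A B f → Computable A C g → Computable A (B ⊗ C) (λ x → f x , g x)
⟨ c , d ⟩ .program = ⟪ program c , program d ⟫
⟨ c , d ⟩ .bound   = var ⊕ bound c ⊕ bound d
⟨ c , d ⟩ .halts x with halts c x | halts d x
... | t , run , t≤ | u , run′ , u≤ = _ , ⇓pair run run′ , +-mono-≤ (+-monoʳ-≤ _ t≤) u≤

fst : Computable (A ⊗ B) A proj₁
fst .program = left
fst .bound   = var
fst .halts x = _ , ⇓left , ≤-refl

snd : Computable (A ⊗ B) B proj₂
snd .program = right
snd .bound   = var
snd .halts x = _ , ⇓right , ≤-refl

build : Tree → Program
build nil     = clear
build (a ∙ b) = ⟪ build a , build b ⟫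

const : (b : Carrier B) → Computable A B (λ _ → b)
const {B} {A} b = record { program = build (Code.⌜ B ⌝ b) ; bound = time (Code.⌜ B ⌝ b) ; halts = λ x → go _ _ }
  where
  time : Tree → Polynomial
  time nil     = var
  time (a ∙ b) = var ⊕ time a ⊕ time b

  go : ∀ y x → ∃[ t ] build y ⊢ x ⇓ y ⟨ t ⟩ × t ≤ ⟦ time y ⟧ (size x)
  go nil     x = _ , ⇓clear , ≤-refl
  go (a ∙ b) x with go a x | go b x
  ... | _ , run , t≤ | _ , run′ , u≤ = _ , ⇓pair run run′ , +-mono-≤ (+-monoʳ-≤ _ t≤) u≤

cons : Computable (A ⊗ ListCode A) (ListCode A) (λ (x , xs) → x ∷ xs)
cons = coerce λ _ → refl

-- X as the disjoint union of a point coded by nil and of Y: what ifhd can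
-- distinguish.
record Split (X Y : Code) : Set where
  field
    stop      : Carrier X
    go        : Carrier Y → Carrier X
    ⌜stop⌝    : Code.⌜ X ⌝ stop ≡ nil
    ⌜go⌝      : ∀ y → Code.⌜ X ⌝ (go y) ≡ Code.⌜ Y ⌝ y
    ⌜Y⌝≢nil   : ∀ y → Code.⌜ Y ⌝ y ≢ nil
    split     : ∀ x → x ≡ stop ⊎ ∃[ y ] x ≡ go y

-- The test looks at the head of the store, so the value to be analysed is paired with a context
-- `B`. In the `nil` case that head carries no information, and `right` drops it before the context
-- is processed.
branch : {X Y : Code} (v : Split X Y) {f : Carrier X × Carrier B → Carrier C} →
         Computable B C (λ b → f (Split.stop v , b)) →
         Computable (Y ⊗ B) C (λ (y , b) → f (Split.go v y , b)) →
         Computable (X ⊗ B) C f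
branch v n c .program = ifhd program c else (right ⨾ program n)
branch v n c .bound   = var ⊕ bound c ⊕ (var ⊕ bound n)
branch {B = B} {X = X} v n c .halts (x , b) with Split.split v x
... | inj₁ refl with halts n b
...   | t , run , t≤ = _ , ⇓else (Split.⌜stop⌝ v) (⇓seq ⇓right run) ,
  let N = Code.∣ X ⊗ B ∣ (Split.stop v , b) in
  +-mono-≤ (m≤m+n N _) (+-monoʳ-≤ N (≤-trans t≤ (⟦⟧-mono (bound n) (m≤n⇒m≤1+n (m≤n+m _ _)))))
branch v n c .halts (x , b) | inj₂ (y , refl) with halts c (y , b)
...   | t , run , t≤ rewrite Split.⌜go⌝ v y =
  _ , ⇓then (Split.⌜Y⌝≢nil v y) run , ≤-trans (+-monoʳ-≤ _ t≤) (m≤m+n _ _)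

uncons : {f : List (Carrier A) × Carrier B → Carrier C} →
         Computable B C (λ b → f ([] , b)) →
         Computable ((A ⊗ ListCode A) ⊗ B) C (λ ((x , xs) , b) → f (x ∷ xs , b)) →
         Computable (ListCode A ⊗ B) C f
uncons = branch record
  { stop = [] ; go = λ (x , xs) → x ∷ xs ; ⌜stop⌝ = refl ; ⌜go⌝ = λ _ → refl ; ⌜Y⌝≢nil = λ _ ()
  ; split = λ { [] → inj₁ refl ; (x ∷ xs) → inj₂ ((x , xs) , refl) }
  }

unary : ∀ {n} → Fin n → Tree
unary zero    = nil
unary (suc i) = nil ∙ unary i

FinCode : ℕ → Code
FinCode n = code (Fin n) unary

-- A chain of tests, each stripping one `nil` off the unary code. The intermediate code
-- `nil ∙ unary i` is that of `suc i`, hence never `nil`; `predecessor` strips it afterwards.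
finite : ∀ {n} {f : Fin n × Carrier B → Carrier C} →
         (∀ i → Computable B C (λ b → f (i , b))) → Computable (FinCode n ⊗ B) C f
finite {n = zero}  cs = record { program = skip ; bound = var ; halts = λ () }
finite {n = suc n} cs = branch
  {Y = code (Fin n) (λ i → nil ∙ unary i)} record
  { stop = zero ; go = suc ; ⌜stop⌝ = refl ; ⌜go⌝ = λ _ → refl ; ⌜Y⌝≢nil = λ _ ()
  ; split = λ { zero → inj₁ refl ; (suc i) → inj₂ (i , refl) }
  }
  (cs zero) (finite (cs ∘ suc) ∘ᶜ ⟨ predecessor ∘ᶜ fst , snd ⟩)
  where
  predecessor : Computable (code (Fin n) (λ i → nil ∙ unary i)) (FinCode n) id
  predecessor .program = right
  predecessor .bound   = var
  predecessor .halts i = _ , ⇓right , ≤-refl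

module _ {A : Code} where
  open Code (ListCode A) using (∣_∣)

  length≤size : ∀ xs → length xs ≤ ∣ xs ∣
  length≤size []       = z≤n
  length≤size (x ∷ xs) = s≤s (≤-trans (length≤size xs) (m≤n+m _ _))

  size-++ˡ : ∀ xs ys → ∣ xs ∣ ≤ ∣ xs ++ ys ∣
  size-++ˡ []       ys = 1≤size _
  size-++ˡ (x ∷ xs) ys = s≤s (+-monoʳ-≤ _ (size-++ˡ xs ys))

  size-++ʳ : ∀ xs ys → ∣ ys ∣ ≤ ∣ xs ++ ys ∣
  size-++ʳ []       ys = ≤-refl
  size-++ʳ (x ∷ xs) ys = m≤n⇒m≤1+n (≤-trans (size-++ʳ xs ys) (m≤n+m _ _))

-- Loops over lists

module _ {A S : Set} (f : S × A → S) where

  run : S → List A → S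
  run = foldl λ s x → f (s , x)

  Along : (List A × S → Set) → List A → S → Set
  Along P []       s = P ([] , s)
  Along P (x ∷ xs) s = P (x ∷ xs , s) × Along P xs (f (s , x))

module _ (A S : Code) (f : Carrier S × Carrier A → Carrier S) where

  -- The list bounds the number of rounds, but not the size of the state, which a polynomial-time
  -- step could square in each round. This condition excludes such growth.
  PolynomiallyBounded : Polynomial → Set
  PolynomiallyBounded q = ∀ xs s →
    Code.∣ S ∣ (run f s xs) ≤ ⟦ q ⟧ (Code.∣ ListCode A ⊗ S ∣ (xs , s))

  open Code (ListCode A ⊗ S) using (∣_∣)

  reachable : Polynomial → Polynomial
  reachable q = con 1 ⊕ var ⊕ q

  -- The state reached after a prefix of the list is the result of the run on
  -- that prefix, so bounding the results of all runs is enough.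
  along-bounded : ∀ q → PolynomiallyBounded q → ∀ xs s →
                  Along f (λ y → ∣ y ∣ ≤ ⟦ reachable q ⟧ ∣ xs , s ∣) xs s
  along-bounded q bounded zs s = go [] zs refl
    where
    here : ∀ ys xs → ys ++ xs ≡ zs → ∣ xs , run f s ys ∣ ≤ ⟦ reachable q ⟧ ∣ zs , s ∣
    here ys xs refl = s≤s (+-mono-≤
      (≤-trans (size-++ʳ ys xs) (m≤n⇒m≤1+n (m≤m+n _ _)))
      (≤-trans (bounded ys s) (⟦⟧-mono q (s≤s (+-monoˡ-≤ _ (size-++ˡ ys xs))))))

    go : ∀ ys xs → ys ++ xs ≡ zs →
         Along f (λ y → ∣ y ∣ ≤ ⟦ reachable q ⟧ ∣ zs , s ∣) xs (run f s ys)
    go ys []       eq = here ys [] eq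
    go ys (x ∷ xs) eq = here ys (x ∷ xs) eq ,
      subst (Along f _ xs) (List.foldl-++ _ s ys (x ∷ []))
        (go (ys ++ x ∷ []) xs (trans (List.++-assoc ys (x ∷ []) xs) eq))

-- The list still to be consumed is the head of the store, so the guard fails exactly when it is
-- exhausted. Each round costs a test and the body on a reachable store.
fold : {f : Carrier S × Carrier A → Carrier S} → Computable (S ⊗ A) S f →
       ∀ q → PolynomiallyBounded A S f q →
       Computable (ListCode A ⊗ S) S (λ (xs , s) → run f s xs)
fold {S} {A} {f} c q bounded = record
  { program = while (program body) ⨾ right
  -- The second `time` pays for `right`: its cost is the size of the result of the loop, hence at
  -- most the time of the loop.
  ; bound   = time ⊕ time
  ; halts   = λ (xs , s) →
      let t , loop , t≤ = iterate xs s (along-bounded A S f q bounded xs s)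
          t≤time = ≤-trans t≤ (+-monoˡ-≤ _ (*-monoˡ-≤ _ (≤-trans (length≤size {A} xs) (m≤n⇒m≤1+n (m≤m+n _ _)))))
      in _ , ⇓seq loop ⇓right , +-mono-≤ t≤time (≤-trans (result≤time loop) t≤time)
  }
  where
  reach = reachable A S f q

  body : Computable ((A ⊗ ListCode A) ⊗ S) (ListCode A ⊗ S) (λ ((x , xs) , s) → xs , f (s , x))
  body = ⟨ snd ∘ᶜ fst , c ∘ᶜ ⟨ snd , fst ∘ᶜ fst ⟩ ⟩

  time : Polynomial
  time = var ⊛ (reach ⊕ bound body ∘ₚ reach) ⊕ reach

  open Code (ListCode A ⊗ S) using (⌜_⌝; ∣_∣)

  iterate : ∀ xs s {M} → Along f (λ y → ∣ y ∣ ≤ M) xs s →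
            ∃[ t ] while (program body) ⊢ ⌜ xs , s ⌝ ⇓ ⌜ [] , run f s xs ⌝ ⟨ t ⟩ ×
                   t ≤ length xs * (M + ⟦ bound body ⟧ M) + M
  iterate []       s le         = _ , ⇓stop refl , le
  iterate (x ∷ xs) s {M} (le , les) with halts body ((x , xs) , s) | iterate xs (f (s , x)) les
  ... | t , run₁ , t≤ | u , run₂ , u≤ = _ , ⇓loop (λ ()) run₁ run₂ , (begin
    _ + t + u                                                      ≤⟨ +-mono-≤ (+-mono-≤ le (≤-trans t≤ (⟦⟧-mono (bound body) le))) u≤ ⟩
    M + ⟦ bound body ⟧ M + (length xs * (M + ⟦ bound body ⟧ M) + M) ≡⟨ +-assoc (M + ⟦ bound body ⟧ M) _ M ⟨
    _                                                              ∎)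
    where open ≤-Reasoning

module _ (A B S : Code) (next : Carrier S × Carrier A → Carrier S)
         (output : Carrier S × Carrier A → Carrier B) where

  -- The output is extended at the front, so it appears in reverse order.
  step : (Carrier S × List (Carrier B)) × Carrier A → Carrier S × List (Carrier B)
  step ((s , out) , x) = next (s , x) , output (s , x) ∷ out

  transduce : Carrier S → List (Carrier A) → List (Carrier B)
  transduce s []       = []
  transduce s (x ∷ xs) = output (s , x) ∷ transduce (next (s , x)) xs

  run-step : ∀ s out xs → run step (s , out) xs ≡ (run next s xs , transduce s xs ʳ++ out)
  run-step s out []       = refl
  run-step s out (x ∷ xs) = run-step (next (s , x)) (output (s , x) ∷ out) xs

-- Only the state of the machine needs a growth assumption. Each output symbol is bounded by the
-- time `cᵒ` takes on a reachable state, and there is one symbol per list entry.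
mealy : {next : Carrier S × Carrier A → Carrier S} {output : Carrier S × Carrier A → Carrier B} →
        Computable (S ⊗ A) S next → Computable (S ⊗ A) B output →
        ∀ q → PolynomiallyBounded A S next q →
        Computable (ListCode A ⊗ S ⊗ ListCode B) (S ⊗ ListCode B)
                   (λ (xs , s) → run (step A B S next output) s xs)
mealy {S} {A} {B} {next} {output} cⁿ cᵒ q bounded =
  fold ⟨ cⁿ ∘ᶜ ⟨ fst ∘ᶜ fst , snd ⟩ , cons ∘ᶜ ⟨ cᵒ ∘ᶜ ⟨ fst ∘ᶜ fst , snd ⟩ , snd ∘ᶜ fst ⟩ ⟩
       (con 1 ⊕ q ⊕ (var ⊕ var ⊛ growth)) step-bounded
  where
  reach growth : Polynomial
  reach  = reachable A S next q
  growth = con 1 ⊕ bound cᵒ ∘ₚ reach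

  open Code (ListCode A ⊗ S) using (∣_∣)

  output-size : ∀ xs s out {M} → Along next (λ y → ∣ y ∣ ≤ M) xs s →
                Code.∣ ListCode B ∣ (transduce A B S next output s xs ʳ++ out) ≤
                Code.∣ ListCode B ∣ out + length xs * (1 + ⟦ bound cᵒ ⟧ M)
  output-size []       s out _ = m≤m+n _ _
  output-size (x ∷ xs) s out {M} (le , les) = begin
    _                                                           ≤⟨ output-size xs _ _ les ⟩
    suc (Code.∣ B ∣ (output (s , x)) + size-out) + rest         ≤⟨ +-monoˡ-≤ rest (s≤s (+-monoˡ-≤ size-out
                                                                     (≤-trans (result≤bound cᵒ (s , x)) (⟦⟧-mono (bound cᵒ) head≤M)))) ⟩
    suc (⟦ bound cᵒ ⟧ M + size-out) + rest                      ≡⟨ swap (⟦ bound cᵒ ⟧ M) size-out rest ⟩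
    size-out + (suc (⟦ bound cᵒ ⟧ M) + rest)                    ∎
    where
    open ≤-Reasoning
    rest = length xs * (1 + ⟦ bound cᵒ ⟧ M)
    size-out = Code.∣ ListCode B ∣ out
    swap : ∀ a b c → suc (a + b) + c ≡ b + (suc a + c)
    swap = solve-∀
    head≤M : Code.∣ S ⊗ A ∣ (s , x) ≤ M
    head≤M = ≤-trans (s≤s (≤-trans (≤-reflexive (+-comm (Code.∣ S ∣ s) (Code.∣ A ∣ x)))
      (+-monoˡ-≤ _ (m≤n⇒m≤1+n (m≤m+n (Code.∣ A ∣ x) _))))) le

  step-bounded : PolynomiallyBounded A (S ⊗ ListCode B) (step A B S next output)
                   (con 1 ⊕ q ⊕ (var ⊕ var ⊛ growth))
  step-bounded xs (s , out) rewrite run-step A B S next output s out xs = s≤s (+-mono-≤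
    (≤-trans (bounded xs s) (⟦⟧-mono q small))
    (≤-trans (output-size xs s out (along-bounded A S next q bounded xs s)) (+-mono-≤
      (m≤n⇒m≤1+n (≤-trans (m≤n⇒m≤1+n (m≤n+m _ (Code.∣ S ∣ s))) (m≤n+m _ (Code.∣ ListCode A ∣ xs))))
      (*-mono-≤ (≤-trans (length≤size {A} xs) (m≤n⇒m≤1+n (m≤m+n _ _)))
                (s≤s (⟦⟧-mono (bound cᵒ) (⟦⟧-mono reach small)))))))
    where
    small : ∣ xs , s ∣ ≤ Code.∣ ListCode A ⊗ S ⊗ ListCode B ∣ (xs , s , out)
    small = s≤s (+-monoʳ-≤ _ (m≤n⇒m≤1+n (m≤m+n _ _)))

UnitCode : Code
UnitCode = code ⊤ λ _ → nil

reverseAppend : Computable (ListCode A ⊗ ListCode A) (ListCode A) (λ (xs , ys) → xs ʳ++ ys)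
reverseAppend {A} = cast (λ (xs , ys) → cong proj₂ (push ys xs))
  (snd ∘ᶜ mealy {S = UnitCode} {next = proj₁} fst snd (con 1) (λ _ _ → ≤-refl) ∘ᶜ ⟨ fst , ⟨ const tt , snd ⟩ ⟩)
  where
  push : ∀ ys xs → run (step A A UnitCode proj₁ proj₂) (tt , ys) xs ≡ (tt , xs ʳ++ ys)
  push ys []       = refl
  push ys (x ∷ xs) = push (x ∷ ys) xs

reversed : Computable (ListCode A) (ListCode A) reverse
reversed = reverseAppend ∘ᶜ ⟨ identity , const [] ⟩

transduced : {next : Carrier S × Carrier A → Carrier S} {output : Carrier S × Carrier A → Carrier B} →
             Computable (S ⊗ A) S next → Computable (S ⊗ A) B output →
             ∀ q → PolynomiallyBounded A S next q →
             Computable (ListCode A ⊗ S) (ListCode B) (λ (xs , s) → transduce A B S next output s xs)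
transduced cⁿ cᵒ q bounded = cast (λ (xs , s) → trans
    (cong (reverse ∘ proj₂) (run-step _ _ _ _ _ s [] xs)) (List.reverse-involutive (transduce _ _ _ _ _ s xs)))
  (reversed ∘ᶜ snd ∘ᶜ mealy cⁿ cᵒ q bounded ∘ᶜ ⟨ fst , ⟨ snd , const [] ⟩ ⟩)

-- The parameter `c` is the state of a machine that never changes its state.
mappedWith : {f : Carrier C × Carrier A → Carrier B} → Computable (C ⊗ A) B f →
             Computable (ListCode A ⊗ C) (ListCode B) (λ (xs , c) → List.map (λ x → f (c , x)) xs)
mappedWith {C} {A} {B} {f} cf = cast (λ (xs , c) → eq c xs)
  (transduced fst cf var λ xs c → ≤-trans (≤-reflexive (cong (Code.∣ C ∣) (same c xs))) (m≤n⇒m≤1+n (m≤n+m _ _)))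
  where
  same : ∀ c xs → run proj₁ c xs ≡ c
  same c []       = refl
  same c (x ∷ xs) = same c xs

  eq : ∀ c xs → transduce A B C proj₁ f c xs ≡ List.map (λ x → f (c , x)) xs
  eq c []       = refl
  eq c (x ∷ xs) = cong (f (c , x) ∷_) (eq c xs)

mapped : {f : Carrier A → Carrier B} → Computable A B f →
         Computable (ListCode A) (ListCode B) (List.map f)
mapped cf = mappedWith {C = UnitCode} (cf ∘ᶜ snd) ∘ᶜ ⟨ identity , const tt ⟩

-- Binary arithmetic

-- The element d of Fin 2 stands for the digit d + 1, so that a numeral
-- has the same code as its value.
Numeral : Set
Numeral = List (Fin 2)

value : Numeral → ℕ
value []       = 0
value (d ∷ ds) = suc (toℕ d) + 2 * value ds

NatCode NumeralCode : Code
NatCode     = code ℕ encodeℕ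
NumeralCode = ListCode (FinCode 2)

open Code NatCode     using () renaming (∣_∣ to ∣_∣ᴺ)
open Code NumeralCode using () renaming (∣_∣ to ∣_∣ᴰ)

digitsᵇ : ℕᵇ → Numeral
digitsᵇ Bin.zero = []
digitsᵇ 1+[2 m ] = zero ∷ digitsᵇ m
digitsᵇ 2[1+ m ] = suc zero ∷ digitsᵇ m

binary : Numeral → ℕᵇ
binary []              = Bin.zero
binary (zero ∷ ds)     = 1+[2 binary ds ]
binary (suc zero ∷ ds) = 2[1+ binary ds ]

toℕ-binary : ∀ ds → Bin.toℕ (binary ds) ≡ value ds
toℕ-binary []              = refl
toℕ-binary (zero ∷ ds)     = cong (λ v → suc (2 * v)) (toℕ-binary ds)
toℕ-binary (suc zero ∷ ds) = trans (*-suc 2 _) (cong (λ v → 2 + 2 * v) (toℕ-binary ds))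

binary-digitsᵇ : ∀ m → binary (digitsᵇ m) ≡ m
binary-digitsᵇ Bin.zero = refl
binary-digitsᵇ 1+[2 m ] = cong 1+[2_] (binary-digitsᵇ m)
binary-digitsᵇ 2[1+ m ] = cong 2[1+_] (binary-digitsᵇ m)

encode-binary : ∀ ds → encodeℕᵇ (binary ds) ≡ Code.⌜ NumeralCode ⌝ ds
encode-binary []              = refl
encode-binary (zero ∷ ds)     = cong (nil ∙_) (encode-binary ds)
encode-binary (suc zero ∷ ds) = cong ((nil ∙ nil) ∙_) (encode-binary ds)

digits : ℕ → Numeral
digits = digitsᵇ ∘ Bin.fromℕ

value-digits : ∀ n → value (digits n) ≡ n
value-digits n = begin
  value (digits n)                             ≡⟨ toℕ-binary (digits n) ⟨
  Bin.toℕ (binary (digitsᵇ (Bin.fromℕ n)))     ≡⟨ cong Bin.toℕ (binary-digitsᵇ (Bin.fromℕ n)) ⟩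
  Bin.toℕ (Bin.fromℕ n)                        ≡⟨ toℕ-fromℕ n ⟩
  n                                            ∎
  where open ≡-Reasoning

encode-value : ∀ ds → encodeℕ (value ds) ≡ Code.⌜ NumeralCode ⌝ ds
encode-value ds = begin
  encodeℕᵇ (Bin.fromℕ (value ds))               ≡⟨ cong encodeℕ (toℕ-binary ds) ⟨
  encodeℕᵇ (Bin.fromℕ (Bin.toℕ (binary ds)))    ≡⟨ cong encodeℕᵇ (fromℕ-toℕ (binary ds)) ⟩
  encodeℕᵇ (binary ds)                          ≡⟨ encode-binary ds ⟩
  Code.⌜ NumeralCode ⌝ ds                       ∎
  where open ≡-Reasoning

encode-digits : ∀ n → Code.⌜ NumeralCode ⌝ (digits n) ≡ encodeℕ n
encode-digits n = trans (sym (encode-value (digits n))) (cong encodeℕ (value-digits n))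

valueᶜ : Computable NumeralCode NatCode value
valueᶜ = coerce encode-value

digitsᶜ : Computable NatCode NumeralCode digits
digitsᶜ = coerce encode-digits

-- Among numerals of length `l` the least consists of digits 1 and has value `2 ^ l - 1`; the
-- greatest, treated next, consists of digits 2 and has value `2 ^ suc l - 2`.
2^length≤suc-value : ∀ ds → 2 ^ length ds ≤ suc (value ds)
2^length≤suc-value []       = ≤-refl
2^length≤suc-value (d ∷ ds) = begin
  2 * 2 ^ length ds                 ≤⟨ *-monoʳ-≤ 2 (2^length≤suc-value ds) ⟩
  2 * suc (value ds)                ≡⟨ *-suc 2 (value ds) ⟩
  2 + 2 * value ds                  ≤⟨ s≤s (s≤s (m≤n+m _ (toℕ d))) ⟩
  suc (suc (toℕ d) + 2 * value ds)  ∎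
  where open ≤-Reasoning

2+value≤2^suc-length : ∀ ds → 2 + value ds ≤ 2 ^ suc (length ds)
2+value≤2^suc-length []       = ≤-refl
2+value≤2^suc-length (d ∷ ds) = begin
  3 + (toℕ d + 2 * value ds)   ≤⟨ +-monoʳ-≤ 3 (+-monoˡ-≤ (2 * value ds) (s≤s⁻¹ (toℕ<n d))) ⟩
  4 + 2 * value ds             ≡⟨ *-distribˡ-+ 2 2 (value ds) ⟨
  2 * (2 + value ds)           ≤⟨ *-monoʳ-≤ 2 (2+value≤2^suc-length ds) ⟩
  2 * 2 ^ suc (length ds)      ∎
  where open ≤-Reasoning

-- A digit takes one list node and a tree of size at most 3, hence the 4.
size-numeral≤ : ∀ ds → ∣ ds ∣ᴰ ≤ 1 + length ds * 4
size-numeral≤ []       = ≤-refl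
size-numeral≤ (d ∷ ds) = s≤s (≤-trans (+-mono-≤ (digit≤3 d) (size-numeral≤ ds)) (≤-reflexive (+-suc 3 _)))
  where
  digit≤3 : ∀ d → size (unary {2} d) ≤ 3
  digit≤3 zero       = s≤s z≤n
  digit≤3 (suc zero) = ≤-refl

suc-length≤size : ∀ ds → suc (length ds) ≤ ∣ ds ∣ᴰ
suc-length≤size []       = ≤-refl
suc-length≤size (d ∷ ds) = s≤s (≤-trans (suc-length≤size ds) (m≤n+m _ _))

-- Together with `<2^⇒size≤` this turns size estimates into exponent estimates: under multiplication
-- exponents add, and addition costs one more.
n<2^size : ∀ n → n < 2 ^ ∣ n ∣ᴺ
n<2^size n = begin-strict
  n                               ≡⟨ value-digits n ⟨
  value (digits n)                <⟨ ≤-trans (n≤1+n _) (2+value≤2^suc-length (digits n)) ⟩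
  2 ^ suc (length (digits n))     ≤⟨ ^-monoʳ-≤ 2 (suc-length≤size (digits n)) ⟩
  2 ^ ∣ digits n ∣ᴰ               ≡⟨ cong (λ x → 2 ^ size x) (encode-digits n) ⟩
  2 ^ ∣ n ∣ᴺ                      ∎
  where open ≤-Reasoning

2^-cancel-≤ : ∀ k l → 2 ^ k ≤ 2 ^ l → k ≤ l
2^-cancel-≤ k l le = ≮⇒≥ λ l<k → ≤⇒≯ le (^-monoʳ-< 2 ≤-refl l<k)

<2^⇒size≤ : ∀ k → a < 2 ^ k → ∣ a ∣ᴺ ≤ 1 + k * 4
<2^⇒size≤ {a} k a<2^k = begin
  ∣ a ∣ᴺ                        ≡⟨ cong size (encode-digits a) ⟨
  ∣ digits a ∣ᴰ                 ≤⟨ size-numeral≤ (digits a) ⟩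
  1 + length (digits a) * 4     ≤⟨ s≤s (*-monoˡ-≤ 4 (2^-cancel-≤ (length (digits a)) k (≤-trans (2^length≤suc-value (digits a))
                                     (subst (_< 2 ^ k) (sym (value-digits a)) a<2^k)))) ⟩
  1 + k * 4                     ∎
  where open ≤-Reasoning

<2^-weaken : k ≤ l → a < 2 ^ k → a < 2 ^ l
<2^-weaken {k} {l} k≤l a< = ≤-trans a< (^-monoʳ-≤ 2 k≤l)

*-<2^ : ∀ k l → a < 2 ^ k → b < 2 ^ l → a * b < 2 ^ (k + l)
*-<2^ {a} {b} k l a< b< = subst (a * b <_) (sym (^-distribˡ-+-* 2 k l)) (*-mono-< a< b<)

+-<2^ : ∀ k → a < 2 ^ k → b < 2 ^ k → a + b < 2 ^ suc k
+-<2^ {a} {b} k a< b< = subst (a + b <_) (cong (2 ^ k +_) (sym (+-identityʳ _))) (+-mono-< a< b<)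

-- Addition of numerals

table : ∀ {n} (f : Fin n → Carrier B) → Computable (FinCode n) B f
table f = finite {B = UnitCode} (λ i → const (f i)) ∘ᶜ ⟨ identity , const tt ⟩

-- An exhausted numeral behaves as if it continued with the digit 0.
leading : Numeral → Fin 3
leading []       = zero
leading (d ∷ ds) = suc d

rest : {X : Set} → List X → List X
rest []       = []
rest (x ∷ xs) = xs

value-leading : ∀ ds → value ds ≡ toℕ (leading ds) + 2 * value (rest ds)
value-leading []       = refl
value-leading (d ∷ ds) = refl

-- The digits are 1 and 2, so carries range over 0, 1 and 2.
module FullAdder (a : Fin 2) (b c : Fin 3) where
  total : ℕ
  -- The digit meant by `a` is `suc (toℕ a)`, and the digit put out is likewise `suc (toℕ digit)`;
  -- these two ones cancel and are left out.
  total = toℕ a + toℕ b + toℕ c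

  carry<3 : total / 2 < 3
  carry<3 = m<n*o⇒m/o<n {total} {3} {2}
    (s≤s (+-mono-≤ (+-mono-≤ (s≤s⁻¹ (toℕ<n a)) (s≤s⁻¹ (toℕ<n b))) (s≤s⁻¹ (toℕ<n c))))

  digit : Fin 2
  digit = fromℕ< (m%n<n total 2)

  carry : Fin 3
  carry = fromℕ< carry<3

  total≡ : total ≡ toℕ digit + 2 * toℕ carry
  total≡ = begin
    total                              ≡⟨ m≡m%n+[m/n]*n total 2 ⟩
    total % 2 + total / 2 * 2          ≡⟨ cong (total % 2 +_) (*-comm (total / 2) 2) ⟩
    total % 2 + 2 * (total / 2)        ≡⟨ cong₂ (λ x y → x + 2 * y) (toℕ-fromℕ< (m%n<n total 2)) (toℕ-fromℕ< carry<3) ⟨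
    toℕ digit + 2 * toℕ carry          ∎
    where open ≡-Reasoning

AdderState : Code
AdderState = NumeralCode ⊗ FinCode 3

adderNext : Carrier AdderState × Fin 2 → Carrier AdderState
adderNext ((n , c) , d) = rest n , FullAdder.carry d (leading n) c

adderOutput : Carrier AdderState × Fin 2 → Fin 2
adderOutput ((n , c) , d) = FullAdder.digit d (leading n) c

adder : (Carrier AdderState × Numeral) × Fin 2 → Carrier AdderState × Numeral
adder = step (FinCode 2) (FinCode 2) AdderState adderNext adderOutput

-- There is no digit 0, so the carry 0 contributes no digit at all.
top : Fin 3 → Numeral
top zero    = []
top (suc d) = d ∷ []

value-top : ∀ c → value (top c) ≡ toℕ c
value-top zero    = refl
value-top (suc d) = cong suc (+-identityʳ (toℕ d))

-- The digits in ds, most significant first, below a numeral of value n.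
below : ℕ → Numeral → ℕ
below = foldl λ n d → suc (toℕ d) + 2 * n

value-ʳ++ : ∀ ds es → value (ds ʳ++ es) ≡ below (value es) ds
value-ʳ++ []       es = refl
value-ʳ++ (d ∷ ds) es = value-ʳ++ ds (d ∷ es)

contents : Carrier AdderState × Numeral → ℕ
contents ((n , c) , out) = below (value n + toℕ c) out

-- The right-hand side is a loop invariant: a step moves the lowest digit of the pending sum to the
-- output, and what remains counts twice below it.
run-adder : ∀ n c out ds → contents (run adder ((n , c) , out) ds) ≡ below (value ds + value n + toℕ c) out
run-adder n c out []       = refl
run-adder n c out (d ∷ ds) = trans (run-adder (rest n) _ _ ds) (cong (λ x → below x out) (begin
  suc (toℕ digit) + 2 * (value ds + value (rest n) + toℕ carry)        ≡⟨ regroup₁ (toℕ digit) (value ds) (value (rest n)) (toℕ carry) ⟩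
  suc (toℕ digit + 2 * toℕ carry) + 2 * value ds + 2 * value (rest n)  ≡⟨ cong (λ t → suc t + 2 * value ds + 2 * value (rest n)) total≡ ⟨
  suc total + 2 * value ds + 2 * value (rest n)                        ≡⟨ regroup₂ (toℕ d) (toℕ (leading n)) (toℕ c) (value ds) (value (rest n)) ⟩
  suc (toℕ d) + 2 * value ds + (toℕ (leading n) + 2 * value (rest n)) + toℕ c
                                                                       ≡⟨ cong (λ v → suc (toℕ d) + 2 * value ds + v + toℕ c) (value-leading n) ⟨
  suc (toℕ d) + 2 * value ds + value n + toℕ c                         ∎))
  where
  open ≡-Reasoning
  open FullAdder d (leading n) c
  regroup₁ : ∀ o v w c → suc o + 2 * (v + w + c) ≡ suc (o + 2 * c) + 2 * v + 2 * w
  regroup₁ = solve-∀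
  regroup₂ : ∀ a b c v w → suc (a + b + c) + 2 * v + 2 * w ≡ suc a + 2 * v + (b + 2 * w) + c
  regroup₂ = solve-∀

exhausted : ∀ c out ds → proj₁ (proj₁ (run adder (([] , c) , out) ds)) ≡ []
exhausted c out []       = refl
exhausted c out (d ∷ ds) = exhausted _ _ ds

-- The digits of n which are left when those of m are exhausted form the
-- first summand of the second pass.
firstPass secondPass : Numeral → Numeral → Carrier AdderState × Numeral
firstPass m n = run adder ((n , zero) , []) m
secondPass m n = let (n′ , c) , out = firstPass m n in run adder (([] , c) , out) n′

sumNumeral : Numeral → Numeral → Numeral
sumNumeral m n = let (_ , c) , out = secondPass m n in out ʳ++ top c

value-sumNumeral : ∀ m n → value (sumNumeral m n) ≡ value m + value n
value-sumNumeral m n =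
  let (n′ , c′) , out′ = firstPass m n
      (n″ , c″) , out″ = secondPass m n in begin
  value (out″ ʳ++ top c″)              ≡⟨ value-ʳ++ out″ (top c″) ⟩
  below (value (top c″)) out″          ≡⟨ cong (λ v → below v out″) (value-top c″) ⟩
  below (value [] + toℕ c″) out″       ≡⟨ cong (λ n → below (value n + toℕ c″) out″) (exhausted c′ out′ n′) ⟨
  contents (secondPass m n)            ≡⟨ run-adder [] c′ out′ n′ ⟩
  below (value n′ + 0 + toℕ c′) out′   ≡⟨ cong (λ v → below (v + toℕ c′) out′) (+-identityʳ (value n′)) ⟩
  contents (firstPass m n)             ≡⟨ run-adder n zero [] m ⟩
  value m + value n + 0                ≡⟨ +-identityʳ _ ⟩
  value m + value n                    ∎
  where open ≡-Reasoning

restᶜ : Computable (ListCode A) (ListCode A) rest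
restᶜ {A} = uncons {B = UnitCode} {f = λ (xs , _) → rest xs} (const []) (snd ∘ᶜ fst) ∘ᶜ ⟨ identity , const tt ⟩

size-rest : ∀ xs → Code.∣ ListCode A ∣ (rest xs) ≤ Code.∣ ListCode A ∣ xs
size-rest []       = ≤-refl
size-rest (x ∷ xs) = m≤n⇒m≤1+n (m≤n+m _ _)

leadingᶜ : Computable NumeralCode (FinCode 3) leading
leadingᶜ = uncons {B = UnitCode} {f = λ (ds , _) → leading ds} (const zero) (table suc ∘ᶜ fst ∘ᶜ fst) ∘ᶜ ⟨ identity , const tt ⟩

fullAdderᶜ : (f : Fin 2 → Fin 3 → Fin 3 → Carrier B) →
             Computable (AdderState ⊗ FinCode 2) B (λ ((n , c) , d) → f d (leading n) c)
fullAdderᶜ f = finite {f = λ (d , b , c) → f d b c} (λ d → finite λ b → table (f d b))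
             ∘ᶜ ⟨ snd , ⟨ leadingᶜ ∘ᶜ fst ∘ᶜ fst , snd ∘ᶜ fst ⟩ ⟩

adderᶜ : Computable (NumeralCode ⊗ AdderState ⊗ NumeralCode) (AdderState ⊗ NumeralCode)
                    (λ (ds , s) → run adder s ds)
adderᶜ = mealy ⟨ restᶜ ∘ᶜ fst ∘ᶜ fst , fullAdderᶜ FullAdder.carry ⟩ (fullAdderᶜ FullAdder.digit)
  -- One node and at most 5 for the carry give 6; the numeral in the state only gets shorter.
  (con 6 ⊕ var) λ ds (n , c) → ≤-trans (bounded n c ds) (+-monoʳ-≤ 6 (m≤n⇒m≤1+n (m≤n⇒m≤o+n _ (m≤n⇒m≤1+n (m≤m+n _ _)))))
  where
  carry≤5 : ∀ c → size (unary {3} c) ≤ 5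
  carry≤5 zero             = s≤s z≤n
  carry≤5 (suc zero)       = s≤s (s≤s (s≤s z≤n))
  carry≤5 (suc (suc zero)) = ≤-refl

  bounded : ∀ n c ds → Code.∣ AdderState ∣ (run adderNext (n , c) ds) ≤ 6 + ∣ n ∣ᴰ
  bounded n c []       = s≤s (≤-trans (+-monoʳ-≤ _ (carry≤5 c)) (≤-reflexive (+-comm _ 5)))
  bounded n c (d ∷ ds) = ≤-trans (bounded (rest n) _ ds) (+-monoʳ-≤ 6 (size-rest n))

sumNumeralᶜ : Computable (NumeralCode ⊗ NumeralCode) NumeralCode (λ (m , n) → sumNumeral m n)
sumNumeralᶜ = reverseAppend ∘ᶜ ⟨ snd , table top ∘ᶜ snd ∘ᶜ fst ⟩
  ∘ᶜ adderᶜ ∘ᶜ ⟨ fst ∘ᶜ fst , ⟨ ⟨ const [] , snd ∘ᶜ fst ⟩ , snd ⟩ ⟩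
  ∘ᶜ adderᶜ ∘ᶜ ⟨ fst , ⟨ ⟨ snd , const zero ⟩ , const [] ⟩ ⟩

+ᶜ : Computable (NatCode ⊗ NatCode) NatCode (λ (m , n) → m + n)
+ᶜ = cast (λ (m , n) → trans (value-sumNumeral (digits m) (digits n)) (cong₂ _+_ (value-digits m) (value-digits n)))
  (valueᶜ ∘ᶜ sumNumeralᶜ ∘ᶜ ⟨ digitsᶜ ∘ᶜ fst , digitsᶜ ∘ᶜ snd ⟩)

multiplier : (ℕ × ℕ) × Fin 2 → ℕ × ℕ
multiplier ((acc , n) , d) = acc + suc (toℕ d) * n , n + n

-- Double-and-add. The closed form also yields the size bound for the loop.
run-multiplier : ∀ acc n ds → run multiplier (acc , n) ds ≡ (acc + value ds * n , 2 ^ length ds * n)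
run-multiplier acc n []       = cong₂ _,_ (sym (+-identityʳ acc)) (sym (+-identityʳ n))
run-multiplier acc n (d ∷ ds) = trans (run-multiplier _ (n + n) ds) (cong₂ _,_
  (eq₁ acc (toℕ d) n (value ds)) (eq₂ n (2 ^ length ds)))
  where
  eq₁ : ∀ acc d n v → acc + suc d * n + v * (n + n) ≡ acc + (suc d + 2 * v) * n
  eq₁ = solve-∀
  eq₂ : ∀ n p → p * (n + n) ≡ 2 * p * n
  eq₂ = solve-∀

multiplierᶜ : Computable ((NatCode ⊗ NatCode) ⊗ FinCode 2) (NatCode ⊗ NatCode) multiplier
multiplierᶜ = ⟨ add , +ᶜ ∘ᶜ ⟨ snd ∘ᶜ fst , snd ∘ᶜ fst ⟩ ⟩
  where
  addMultiple : (d : Fin 2) → Computable (NatCode ⊗ NatCode) NatCode (λ (acc , n) → acc + suc (toℕ d) * n)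
  addMultiple zero       = cast (λ (acc , n) → cong (acc +_) (sym (+-identityʳ n))) +ᶜ
  addMultiple (suc zero) = cast (λ (acc , n) → cong (λ m → acc + (n + m)) (sym (+-identityʳ n)))
                                (+ᶜ ∘ᶜ ⟨ fst , +ᶜ ∘ᶜ ⟨ snd , snd ⟩ ⟩)

  add = finite {f = λ (d , acc , n) → acc + suc (toℕ d) * n} addMultiple ∘ᶜ ⟨ snd , fst ⟩

*ᶜ : Computable (NatCode ⊗ NatCode) NatCode (λ (m , n) → m * n)
*ᶜ = cast (λ (m , n) → trans (cong proj₁ (run-multiplier 0 n (digits m))) (cong (_* n) (value-digits m)))
  (fst ∘ᶜ fold multiplierᶜ (con 1 ⊕ sizeBound ⊕ sizeBound) bounded ∘ᶜ ⟨ digitsᶜ ∘ᶜ fst , ⟨ const 0 , snd ⟩ ⟩)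
  where
  -- Accumulator and product are both below `2 ^ N` for the input size `N`, so their sum is below
  -- `2 ^ suc N`.
  sizeBound = con 1 ⊕ (con 1 ⊕ var) ⊛ con 4

  bounded : PolynomiallyBounded (FinCode 2) (NatCode ⊗ NatCode) multiplier (con 1 ⊕ sizeBound ⊕ sizeBound)
  bounded ds (acc , n) rewrite run-multiplier acc n ds = s≤s (+-mono-≤
    (<2^⇒size≤ (suc N) (+-<2^ N
      (<2^-weaken {k = ∣ acc ∣ᴺ} acc≤N (n<2^size acc))
      (<2^-weaken {k = ∣ ds ∣ᴰ + ∣ n ∣ᴺ} ds+n≤N (*-<2^ ∣ ds ∣ᴰ ∣ n ∣ᴺ (value<2^size ds) (n<2^size n)))))
    (<2^⇒size≤ (suc N) (<2^-weaken {k = ∣ ds ∣ᴰ + ∣ n ∣ᴺ} (m≤n⇒m≤1+n ds+n≤N)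
      (*-<2^ ∣ ds ∣ᴰ ∣ n ∣ᴺ (^-monoʳ-< 2 ≤-refl (suc-length≤size ds)) (n<2^size n)))))
    where
    N = Code.∣ NumeralCode ⊗ NatCode ⊗ NatCode ∣ (ds , acc , n)

    value<2^size : ∀ ds → value ds < 2 ^ ∣ ds ∣ᴰ
    value<2^size ds = subst (λ x → value ds < 2 ^ size x) (encode-value ds) (n<2^size (value ds))

    acc≤N : ∣ acc ∣ᴺ ≤ N
    acc≤N = m≤n⇒m≤1+n (m≤n⇒m≤o+n ∣ ds ∣ᴰ (m≤n⇒m≤1+n (m≤m+n _ _)))

    ds+n≤N : ∣ ds ∣ᴰ + ∣ n ∣ᴺ ≤ N
    ds+n≤N = m≤n⇒m≤1+n (+-monoʳ-≤ ∣ ds ∣ᴰ (m≤n⇒m≤1+n (m≤n+m _ _)))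

-- Aggregation of the scenarios

-- Fractions need not be reduced.  FractionCode is the code of a
-- nonnegative rational.
Fraction : Set
Fraction = ℕ × ℕ

FractionCode PairCode : Code
FractionCode = code Fraction λ (a , b) → (nil ∙ encodeℕ a) ∙ encodeℕ b
PairCode     = NatCode ⊗ NatCode

numerator : Computable FractionCode NatCode proj₁
numerator = snd ∘ᶜ fst ∘ᶜ coerce {B = (UnitCode ⊗ NatCode) ⊗ NatCode} {f = λ (a , b) → (tt , a) , b} λ _ → refl

denominator : Computable FractionCode NatCode proj₂
denominator = snd ∘ᶜ coerce {B = (UnitCode ⊗ NatCode) ⊗ NatCode} {f = λ (a , b) → (tt , a) , b} λ _ → refl

natural : Computable NatCode FractionCode (λ n → n , 1)
natural = coerce {A = (UnitCode ⊗ NatCode) ⊗ NatCode} {f = λ ((_ , a) , b) → a , b} (λ _ → refl)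
        ∘ᶜ ⟨ ⟨ const tt , identity ⟩ , const 1 ⟩

addFraction : Fraction × Fraction → Fraction
addFraction ((m , d) , (a , b)) = m * b + a * d , d * b

sumFractions : List Fraction → Fraction
sumFractions = run addFraction (0 , 1)

addFractionᶜ : Computable (PairCode ⊗ FractionCode) PairCode addFraction
addFractionᶜ = ⟨ +ᶜ ∘ᶜ ⟨ *ᶜ ∘ᶜ ⟨ fst ∘ᶜ fst , denominator ∘ᶜ snd ⟩ , *ᶜ ∘ᶜ ⟨ numerator ∘ᶜ snd , snd ∘ᶜ fst ⟩ ⟩
               , *ᶜ ∘ᶜ ⟨ snd ∘ᶜ fst , denominator ∘ᶜ snd ⟩ ⟩

PairBelow : ℕ → ℕ × ℕ → Set
PairBelow k (m , n) = m < 2 ^ k × n < 2 ^ k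

pair-below : ∀ m n {k} → ∣ m ∣ᴺ ≤ k → ∣ n ∣ᴺ ≤ k → PairBelow k (m , n)
pair-below m n m≤ n≤ = <2^-weaken {k = ∣ m ∣ᴺ} m≤ (n<2^size m) , <2^-weaken {k = ∣ n ∣ᴺ} n≤ (n<2^size n)

pair-size : ∀ {k p} → PairBelow k p → Code.∣ PairCode ∣ p ≤ 1 + ((1 + k * 4) + (1 + k * 4))
pair-size {k} (m< , n<) = s≤s (+-mono-≤ (<2^⇒size≤ k m<) (<2^⇒size≤ k n<))

sumFractionsᶜ : Computable (ListCode FractionCode) PairCode sumFractions
sumFractionsᶜ = fold addFractionᶜ sizeBound bounded ∘ᶜ ⟨ identity , const (0 , 1) ⟩
  where
  -- In `var ⊕ var` one summand covers the exponent of the initial pair, the other the growth along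
  -- the list.
  sizeBound = con 1 ⊕ ((con 1 ⊕ (var ⊕ var) ⊛ con 4) ⊕ (con 1 ⊕ (var ⊕ var) ⊛ con 4))

  -- A fraction raises the exponent by its size, for the products, and by 1, for the sum of two
  -- products. The list node holding the fraction accounts for that 1.
  grow : ∀ {k s} xs → PairBelow k s → PairBelow (k + Code.∣ ListCode FractionCode ∣ xs) (run addFraction s xs)
  grow {k} [] (m< , d<) = <2^-weaken {k = k} (m≤m+n k _) m< , <2^-weaken {k = k} (m≤m+n k _) d<
  grow {k} {m , d} ((a , b) ∷ xs) (m< , d<) =
    subst (λ l → PairBelow l (run addFraction (addFraction ((m , d) , (a , b))) xs)) (eq k ∣x∣ _)
    (grow {suc (k + ∣x∣)} xs
      ( +-<2^ (k + ∣x∣)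
          (*-<2^ k ∣x∣ m< b<)
          (subst (λ l → a * d < 2 ^ l) (+-comm ∣x∣ k) (*-<2^ ∣x∣ k a< d<))
      , <2^-weaken {k = k + ∣x∣} (n≤1+n _) (*-<2^ k ∣x∣ d< b<)))
    where
    ∣x∣ = Code.∣ FractionCode ∣ (a , b)
    ab< : PairBelow ∣x∣ (a , b)
    ab< = pair-below a b (m≤n⇒m≤1+n (m≤n⇒m≤1+n (m≤n⇒m≤1+n (m≤m+n _ _)))) (m≤n⇒m≤1+n (m≤n+m _ _))
    a< = proj₁ ab<
    b< = proj₂ ab<
    eq : ∀ k x y → suc (k + x) + y ≡ k + suc (x + y)
    eq = solve-∀

  bounded : PolynomiallyBounded FractionCode PairCode addFraction sizeBound
  bounded xs s@(m , d) = pair-size {N + N} (<2^-both (grow {N} {s} xs (pair-below m d {N}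
      (m≤n⇒m≤1+n (m≤n⇒m≤o+n ∣xs∣ (m≤n⇒m≤1+n (m≤m+n _ _))))
      (m≤n⇒m≤1+n (m≤n⇒m≤o+n ∣xs∣ (m≤n⇒m≤1+n (m≤n+m _ _)))))))
    where
    ∣xs∣ = Code.∣ ListCode FractionCode ∣ xs
    N = Code.∣ ListCode FractionCode ⊗ PairCode ∣ (xs , s)
    N+xs≤ : N + ∣xs∣ ≤ N + N
    N+xs≤ = +-monoʳ-≤ N (m≤n⇒m≤1+n (m≤m+n _ _))
    <2^-both : ∀ {p} → PairBelow (N + ∣xs∣) p → PairBelow (N + N) p
    <2^-both (m< , n<) = <2^-weaken {k = N + ∣xs∣} N+xs≤ m< , <2^-weaken {k = N + ∣xs∣} N+xs≤ n<

-- Column sums and common denominators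

first : {X : Set} → X → List X → X
first x []      = x
first _ (y ∷ _) = y

firstᶜ : (x : Carrier A) → Computable (ListCode A) A (first x)
firstᶜ x = uncons {B = UnitCode} {f = λ (xs , _) → first x xs} (const x) (fst ∘ᶜ fst) ∘ᶜ ⟨ identity , const tt ⟩

Matrix : Set
Matrix = List (List Fraction)

MatrixCode : Code
MatrixCode = ListCode (ListCode FractionCode)

dropColumn : Matrix × Fraction → Matrix
dropColumn (rows , _) = List.map rest rows

-- The default `0 , 1` makes the function total; in a rectangular matrix all rows run out together
-- with the counting row, so it is not reached.
columnSum : Matrix × Fraction → Fraction
columnSum (rows , _) = sumFractions (List.map (first (0 , 1)) rows)

-- The first row only serves to count the columns.
columnSums : Matrix → List Fraction
columnSums rows = transduce FractionCode PairCode MatrixCode dropColumn columnSum rows (first [] rows)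

columnSumsᶜ : Computable MatrixCode (ListCode PairCode) columnSums
columnSumsᶜ = transduced (mapped restᶜ ∘ᶜ fst) (sumFractionsᶜ ∘ᶜ mapped (firstᶜ (0 , 1)) ∘ᶜ fst)
    var (λ xs rows → ≤-trans (bounded rows xs) (m≤n⇒m≤1+n (m≤n+m _ _)))
  ∘ᶜ ⟨ firstᶜ [] , identity ⟩
  where
  open Code MatrixCode using (∣_∣)

  smaller : ∀ rows → ∣ List.map rest rows ∣ ≤ ∣ rows ∣
  smaller []           = ≤-refl
  smaller (row ∷ rows) = s≤s (+-mono-≤ (size-rest {FractionCode} row) (smaller rows))

  bounded : ∀ rows xs → ∣ run dropColumn rows xs ∣ ≤ ∣ rows ∣
  bounded rows []       = ≤-refl
  bounded rows (x ∷ xs) = ≤-trans (bounded (List.map rest rows) xs) (smaller rows)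

-- The state (d , ns) stands for the fractions n / d with n in ns.
clearDenominator : (ℕ × List ℕ) × Fraction → ℕ × List ℕ
clearDenominator ((d , ns) , (a , b)) = d * b , a * d ∷ List.map (b *_) ns

commonDenominator : List Fraction → ℕ × List ℕ
commonDenominator = run clearDenominator (1 , [])

commonDenominatorᶜ : Computable (ListCode PairCode) (NatCode ⊗ ListCode NatCode) commonDenominator
commonDenominatorᶜ =
  fold ⟨ *ᶜ ∘ᶜ ⟨ fst ∘ᶜ fst , snd ∘ᶜ snd ⟩
       , cons ∘ᶜ ⟨ *ᶜ ∘ᶜ ⟨ fst ∘ᶜ snd , fst ∘ᶜ fst ⟩ , mappedWith *ᶜ ∘ᶜ ⟨ snd ∘ᶜ fst , snd ∘ᶜ snd ⟩ ⟩ ⟩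
       sizeBound bounded
  ∘ᶜ ⟨ identity , const (1 , []) ⟩
  where
  bits = var ⊕ var
  -- The list is quadratic: at most `N + N` entries, each below `2 ^ (N + N)`. An entry occupies its
  -- number and a list node, which gives `2 + (N + N) * 4`.
  sizeBound = con 1 ⊕ (con 1 ⊕ bits ⊛ con 4) ⊕ (con 1 ⊕ bits ⊛ (con 2 ⊕ bits ⊛ con 4))

  StateBelow : ℕ → ℕ × List ℕ → Set
  StateBelow k (d , ns) = d < 2 ^ k × All (_< 2 ^ k) ns

  weaken : ∀ {k l s} → k ≤ l → StateBelow k s → StateBelow l s
  weaken {k} k≤l (d< , ns<) = <2^-weaken {k = k} k≤l d< , All.map (<2^-weaken {k = k} k≤l) ns<

  -- A pair contributes just one factor to each entry, its numerator to its own and its denominator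
  -- to the others, so every exponent grows by at most the size of the pair.
  grow : ∀ {k s} ps → StateBelow k s → StateBelow (k + Code.∣ ListCode PairCode ∣ ps) (run clearDenominator s ps)
  grow {k} [] s< = weaken {k} (m≤m+n k _) s<
  grow {k} {d , ns} ((a , b) ∷ ps) (d< , ns<) = weaken {k + ∣p∣ + Code.∣ ListCode PairCode ∣ ps}
    (≤-trans (≤-reflexive (+-assoc k ∣p∣ _)) (+-monoʳ-≤ k (n≤1+n _)))
    (grow {k + ∣p∣} ps
      ( *-<2^ k ∣p∣ d< b<
      , swap (*-<2^ ∣p∣ k a< d<)
      ∷ All.map⁺ (All.map (λ n< → swap (*-<2^ ∣p∣ k b< n<)) ns<)))
    where
    ∣p∣ = Code.∣ PairCode ∣ (a , b)
    ab< : PairBelow ∣p∣ (a , b)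
    ab< = pair-below a b (m≤n⇒m≤1+n (m≤m+n _ _)) (m≤n⇒m≤1+n (m≤n+m _ _))
    a< = proj₁ ab<
    b< = proj₂ ab<
    swap : ∀ {m} → m < 2 ^ (∣p∣ + k) → m < 2 ^ (k + ∣p∣)
    swap {m} = subst (λ l → m < 2 ^ l) (+-comm ∣p∣ k)

  run-length : ∀ s ps → length (proj₂ (run clearDenominator s ps)) ≡ length (proj₂ s) + length ps
  run-length s        []             = sym (+-identityʳ _)
  run-length (d , ns) ((a , b) ∷ ps) = trans (run-length _ ps)
    (trans (cong (λ l → suc l + length ps) (List.length-map (b *_) ns)) (sym (+-suc (length ns) (length ps))))

  list-size : ∀ {k ns} → All (_< 2 ^ k) ns → Code.∣ ListCode NatCode ∣ ns ≤ 1 + length ns * (2 + k * 4)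
  list-size     []         = ≤-refl
  list-size {k} (n< ∷ ns<) = s≤s (≤-trans (+-mono-≤ (<2^⇒size≤ k n<) (list-size {k} ns<)) (≤-reflexive (+-suc (1 + k * 4) _)))

  size<2^ : ∀ ns → All (_< 2 ^ Code.∣ ListCode NatCode ∣ ns) ns
  size<2^ []       = []
  size<2^ (n ∷ ns) = <2^-weaken {k = ∣ n ∣ᴺ} (m≤n⇒m≤1+n (m≤m+n _ _)) (n<2^size n) ∷
    All.map (<2^-weaken {k = Code.∣ ListCode NatCode ∣ ns} (m≤n⇒m≤1+n (m≤n+m _ ∣ n ∣ᴺ))) (size<2^ ns)

  bounded : PolynomiallyBounded PairCode (NatCode ⊗ ListCode NatCode) clearDenominator sizeBound
  bounded ps s@(d , ns) = s≤s (+-mono-≤ (<2^⇒size≤ (N + N) (proj₁ final<))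
    (≤-trans (list-size {N + N} (proj₂ final<)) (s≤s (*-monoˡ-≤ (2 + (N + N) * 4)
      (≤-trans (≤-reflexive (run-length s ps)) (+-mono-≤
        (≤-trans (length≤size {NatCode} ns) ns≤N) (≤-trans (length≤size {PairCode} ps) ps≤N)))))))
    where
    ∣ps∣ = Code.∣ ListCode PairCode ∣ ps
    N = Code.∣ ListCode PairCode ⊗ NatCode ⊗ ListCode NatCode ∣ (ps , s)
    ps≤N : ∣ps∣ ≤ N
    ps≤N = m≤n⇒m≤1+n (m≤m+n _ _)
    ns≤N : Code.∣ ListCode NatCode ∣ ns ≤ N
    ns≤N = m≤n⇒m≤1+n (m≤n⇒m≤o+n ∣ps∣ (m≤n⇒m≤1+n (m≤n+m _ _)))
    final< = weaken {N + ∣ps∣} {N + N} (+-monoʳ-≤ N ps≤N) (grow {N} ps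
      ( <2^-weaken {k = ∣ d ∣ᴺ} (m≤n⇒m≤1+n (m≤n⇒m≤o+n ∣ps∣ (m≤n⇒m≤1+n (m≤m+n _ _)))) (n<2^size d)
      , All.map (<2^-weaken {k = Code.∣ ListCode NatCode ∣ ns} ns≤N) (size<2^ ns)))

-- `proj₂` discards the common denominator and keeps the scaled costs; `reverse` undoes their
-- accumulation at the front.
aggregate : Matrix → List Fraction
aggregate = List.map (λ n → n , 1) ∘ reverse ∘ proj₂ ∘ commonDenominator ∘ columnSums

aggregateᶜ : Computable MatrixCode (ListCode FractionCode) aggregate
aggregateᶜ = mapped natural ∘ᶜ reversed ∘ᶜ snd ∘ᶜ commonDenominatorᶜ ∘ᶜ columnSumsᶜ

-- Correctness of the aggregation

ι : ℕ → ℚ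
ι n = ℤ.+ n ℚ./ 1

-- Division in `ℚ` normalizes by a gcd, which does not reduce for a variable `n`; this equation
-- exposes numerator and denominator.
ι≡mkℚ : ∀ n → ι n ≡ mkℚ (ℤ.+ n) 0 (Coprimality.sym (Coprimality.1-coprimeTo n))
ι≡mkℚ n = ℚ.normalize-coprime (Coprimality.sym (Coprimality.1-coprimeTo n))

toℚᵘ-ι : ∀ n → ℚ.toℚᵘ (ι n) ℚᵘ.≃ ℚᵘ.mkℚᵘ (ℤ.+ n) 0
toℚᵘ-ι n rewrite ι≡mkℚ n = ℚᵘ.≃-refl

ι-+ : ∀ m n → ι (m + n) ≡ ι m ℚ.+ ι n
ι-+ m n = ℚ.toℚᵘ-injective (begin
  ℚ.toℚᵘ (ι (m + n))                              ≈⟨ toℚᵘ-ι (m + n) ⟩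
  ℚᵘ.mkℚᵘ (ℤ.+ (m + n)) 0                         ≈⟨ ℚᵘ.*≡* (cong (ℤ._* ℤ.1ℤ)
                                                       (sym (cong₂ ℤ._+_ (ℤ.*-identityʳ (ℤ.+ m)) (ℤ.*-identityʳ (ℤ.+ n))))) ⟩
  ℚᵘ.mkℚᵘ (ℤ.+ m) 0 ℚᵘ.+ ℚᵘ.mkℚᵘ (ℤ.+ n) 0        ≈⟨ ℚᵘ.+-cong (toℚᵘ-ι m) (toℚᵘ-ι n) ⟨
  ℚ.toℚᵘ (ι m) ℚᵘ.+ ℚ.toℚᵘ (ι n)                  ≈⟨ ℚ.toℚᵘ-homo-+ (ι m) (ι n) ⟨
  ℚ.toℚᵘ (ι m ℚ.+ ι n)                            ∎)
  where open ℚᵘ.≃-Reasoning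

ι-* : ∀ m n → ι (m * n) ≡ ι m ℚ.* ι n
ι-* m n = ℚ.toℚᵘ-injective (begin
  ℚ.toℚᵘ (ι (m * n))                              ≈⟨ toℚᵘ-ι (m * n) ⟩
  ℚᵘ.mkℚᵘ (ℤ.+ (m * n)) 0                         ≈⟨ ℚᵘ.*≡* (cong (ℤ._* ℤ.1ℤ) (ℤ.pos-* m n)) ⟩
  ℚᵘ.mkℚᵘ (ℤ.+ m) 0 ℚᵘ.* ℚᵘ.mkℚᵘ (ℤ.+ n) 0        ≈⟨ ℚᵘ.*-cong (toℚᵘ-ι m) (toℚᵘ-ι n) ⟨
  ℚ.toℚᵘ (ι m) ℚᵘ.* ℚ.toℚᵘ (ι n)                  ≈⟨ ℚ.toℚᵘ-homo-* (ι m) (ι n) ⟨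
  ℚ.toℚᵘ (ι m ℚ.* ι n)                            ∎)
  where open ℚᵘ.≃-Reasoning

ι≥0 : ∀ n → 0ℚ ℚ.≤ ι n
ι≥0 n = ℚ.nonNegative⁻¹ (ι n) {{ℚ.normalize-nonNeg n 1}}

ι>0 : 0 < n → ℚ.Positive (ι n)
ι>0 {n} 0<n = ℚ.normalize-pos n 1 {{_}} {{>-nonZero 0<n}}

infix 4 _Represents_

-- Cross-multiplication avoids division and applies to unreduced fractions.
record _Represents_ (x : Fraction) (q : ℚ) : Set where
  constructor _⨟_
  field
    ratio    : ι (proj₁ x) ≡ q ℚ.* ι (proj₂ x)
    positive : 0 < proj₂ x

fraction : ℚ → Fraction
fraction q = ℤ.∣ ↥ q ∣ , ↧ₙ q

fraction-represents : ∀ q → 0ℚ ℚ.≤ q → fraction q Represents q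
fraction-represents (mkℚ ℤ.-[1+ a ] b-1 _)   (ℚ.*≤* ())
fraction-represents q@(mkℚ (ℤ.+ a) b-1 _) _ = ℚ.toℚᵘ-injective (begin
  ℚ.toℚᵘ (ι a)                                             ≈⟨ toℚᵘ-ι a ⟩
  ℚᵘ.mkℚᵘ (ℤ.+ a) 0                                        ≈⟨ ℚᵘ.*≡* (trans (cong (λ b → ℤ.+ a ℤ.* ℤ.+ b) (*-identityʳ (suc b-1)))
                                                                (sym (ℤ.*-identityʳ _))) ⟩
  ℚᵘ.mkℚᵘ (ℤ.+ a) b-1 ℚᵘ.* ℚᵘ.mkℚᵘ (ℤ.+ suc b-1) 0         ≈⟨ ℚᵘ.*-congˡ {ℚ.toℚᵘ q} (toℚᵘ-ι (suc b-1)) ⟨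
  ℚ.toℚᵘ q ℚᵘ.* ℚ.toℚᵘ (ι (suc b-1))                       ≈⟨ ℚ.toℚᵘ-homo-* q (ι (suc b-1)) ⟨
  ℚ.toℚᵘ (q ℚ.* ι (suc b-1))                               ∎) ⨟ s≤s z≤n
  where open ℚᵘ.≃-Reasoning

encode-fraction : ∀ q → 0ℚ ℚ.≤ q → encodeℚ q ≡ Code.⌜ FractionCode ⌝ (fraction q)
encode-fraction (mkℚ ℤ.-[1+ a ] b-1 _)   (ℚ.*≤* ())
encode-fraction (mkℚ (ℤ.+ a) b-1 _)      _ = refl

encode-ι : ∀ n → encodeℚ (ι n) ≡ Code.⌜ FractionCode ⌝ (n , 1)
encode-ι n = cong encodeℚ (ι≡mkℚ n)

addFraction-represents : ∀ {p q x y} → x Represents p → y Represents q →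
                         addFraction (x , y) Represents (p ℚ.+ q)
addFraction-represents {p} {q} {m , d} {a , b} (m≡ ⨟ 0<d) (a≡ ⨟ 0<b) = (begin
  ι (m * b + a * d)                                        ≡⟨ ι-+ (m * b) (a * d) ⟩
  ι (m * b) ℚ.+ ι (a * d)                                  ≡⟨ cong₂ ℚ._+_ (ι-* m b) (ι-* a d) ⟩
  ι m ℚ.* ι b ℚ.+ ι a ℚ.* ι d                              ≡⟨ cong₂ (λ x y → x ℚ.* ι b ℚ.+ y ℚ.* ι d) m≡ a≡ ⟩
  (p ℚ.* ι d) ℚ.* ι b ℚ.+ (q ℚ.* ι b) ℚ.* ι d              ≡⟨ solve 4 (λ p q d b → (p :* d) :* b :+ (q :* b) :* d := (p :+ q) :* (d :* b))
                                                                refl p q (ι d) (ι b) ⟩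
  (p ℚ.+ q) ℚ.* (ι d ℚ.* ι b)                              ≡⟨ cong ((p ℚ.+ q) ℚ.*_) (ι-* d b) ⟨
  (p ℚ.+ q) ℚ.* ι (d * b)                                  ∎) ⨟ *-mono-≤ 0<d 0<b
  where open ≡-Reasoning

sumFractions-represents : {xs : Vector Fraction n} {qs : Vector ℚ n} → (∀ i → xs i Represents qs i) →
                          sumFractions (tabulate xs) Represents ∑ qs
sumFractions-represents {xs = xs} {qs} reps = subst (sumFractions (tabulate xs) Represents_) (ℚ.+-identityˡ (∑ qs))
  (go (sym (ℚ.*-zeroˡ (ι 1)) ⨟ s≤s z≤n) reps)
  where
  go : ∀ {n s p} {xs : Vector Fraction n} {qs : Vector ℚ n} → s Represents p → (∀ i → xs i Represents qs i) →
       run addFraction s (tabulate xs) Represents (p ℚ.+ ∑ qs)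
  go {zero}  {s} {p} rep _ = subst (s Represents_) (sym (ℚ.+-identityʳ p)) rep
  go {suc n} {s} {p} {xs} {qs} rep reps = subst (run addFraction s (tabulate xs) Represents_) (ℚ.+-assoc p (qs zero) _)
    (go (addFraction-represents rep (reps zero)) (reps ∘ suc))

rows : (Fin k → Fin n → Fraction) → Matrix
rows x = tabulate λ j → tabulate (x j)

columnSums-tabulate : (x : Fin (suc k) → Fin n → Fraction) →
                      columnSums (rows x) ≡ tabulate λ i → sumFractions (tabulate λ j → x j i)
columnSums-tabulate x = go x (x zero)
  where
  -- The counting row is separated from the matrix: only its length matters, and both lose a column
  -- in each step.
  go : ∀ {n} (x : Fin k → Fin n → Fraction) (counter : Fin n → Fraction) →
       transduce FractionCode PairCode MatrixCode dropColumn columnSum (rows x) (tabulate counter) ≡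
       tabulate λ i → sumFractions (tabulate λ j → x j i)
  go {n = zero}  x counter = refl
  go {n = suc n} x counter = cong₂ _∷_
    (cong sumFractions (List.map-tabulate (λ j → tabulate (x j)) (first (0 , 1))))
    (trans (cong (λ r → transduce FractionCode PairCode MatrixCode dropColumn columnSum r (tabulate (counter ∘ suc)))
                 (List.map-tabulate (λ j → tabulate (x j)) rest))
           (go (λ j → x j ∘ suc) (counter ∘ suc)))

record WithDenominator (d : ℕ) (q : ℚ) (m : ℕ) : Set where
  constructor scaled
  field
    ratio : ι m ≡ q ℚ.* ι d

-- The loop invariant. A new denominator multiplies `d` and all old entries alike, so the old ratios
-- persist; new entries go to the front, whence `rs ʳ++ qs`.
run-clearDenominator : ∀ {d ns qs ps rs} → 0 < d → Pointwise (WithDenominator d) qs ns →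
  Pointwise (λ r p → p Represents r) rs ps →
  let d′ , ns′ = run clearDenominator (d , ns) ps in
  0 < d′ × Pointwise (WithDenominator d′) (rs ʳ++ qs) ns′
run-clearDenominator 0<d shared [] = 0<d , shared
run-clearDenominator {d} {ns} {qs} {(a , b) ∷ ps} {r ∷ rs} 0<d shared ((a≡ ⨟ 0<b) ∷ reps) =
  run-clearDenominator (*-mono-≤ 0<d 0<b) (scaled new ∷ scale shared) reps
  where
  open ≡-Reasoning
  new : ι (a * d) ≡ r ℚ.* ι (d * b)
  new = begin
    ι (a * d)                   ≡⟨ ι-* a d ⟩
    ι a ℚ.* ι d                 ≡⟨ cong (ℚ._* ι d) a≡ ⟩
    (r ℚ.* ι b) ℚ.* ι d         ≡⟨ solve 3 (λ r b d → (r :* b) :* d := r :* (d :* b)) refl r (ι b) (ι d) ⟩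
    r ℚ.* (ι d ℚ.* ι b)         ≡⟨ cong (r ℚ.*_) (ι-* d b) ⟨
    r ℚ.* ι (d * b)             ∎
  old : ∀ {q m} → ι m ≡ q ℚ.* ι d → ι (b * m) ≡ q ℚ.* ι (d * b)
  old {q} {m} m≡ = begin
    ι (b * m)                   ≡⟨ ι-* b m ⟩
    ι b ℚ.* ι m                 ≡⟨ cong (ι b ℚ.*_) m≡ ⟩
    ι b ℚ.* (q ℚ.* ι d)         ≡⟨ solve 3 (λ q b d → b :* (q :* d) := q :* (d :* b)) refl q (ι b) (ι d) ⟩
    q ℚ.* (ι d ℚ.* ι b)         ≡⟨ cong (q ℚ.*_) (ι-* d b) ⟨
    q ℚ.* ι (d * b)             ∎
  scale : ∀ {qs ns} → Pointwise (WithDenominator d) qs ns → Pointwise (WithDenominator (d * b)) qs (List.map (b *_) ns)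
  scale []                        = []
  scale (_∷_ {x = q} (scaled m≡) ms) = scaled (old {q} m≡) ∷ scale ms

-- Turns the computed list back into a vector over the ground set, the form in which a cost instance
-- holds its costs.
pointwise-tabulate : ∀ {X Y : Set} {R : X → Y → Set} {xs : Vector X n} {ys} → Pointwise R (tabulate xs) ys →
                     ∃[ f ] ys ≡ tabulate {n = n} f × ∀ i → R (xs i) (f i)
pointwise-tabulate {zero}  []       = (λ ()) , refl , λ ()
pointwise-tabulate {suc n} {xs = xs} (r ∷ rs) with pointwise-tabulate {n} {xs = tail xs} rs
... | f , refl , all = (λ { zero → _ ; (suc i) → f i }) , refl , λ { zero → r ; (suc i) → all i }

commonDenominator-tabulate : {xs : Vector Fraction n} {qs : Vector ℚ n} → (∀ i → xs i Represents qs i) →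
  ∃[ d ] ∃[ ns ] 0 < d × reverse (proj₂ (commonDenominator (tabulate xs))) ≡ tabulate {n = n} ns ×
                 ∀ i → WithDenominator d (qs i) (ns i)
commonDenominator-tabulate {n} {xs} {qs} reps
  with run-clearDenominator {1} {[]} {[]} {tabulate xs} {tabulate qs} (s≤s z≤n) [] (Pointwise.tabulate⁺ reps)
... | 0<d , shared
  with pointwise-tabulate {n} {xs = qs} (subst (λ qs → Pointwise (WithDenominator _) qs _)
         (List.reverse-involutive (tabulate qs)) (Pointwise.reverse⁺ shared))
...   | ns , ns≡ , ns-share = _ , ns , 0<d , ns≡ , ns-share

aggregate-tabulate : {x : Fin (suc k) → Fin n → Fraction} {Γ : Vector (Vector ℚ n) (suc k)} →
  (∀ j i → x j i Represents Γ j i) →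
  ∃[ d ] ∃[ ns ] 0 < d × aggregate (rows x) ≡ tabulate {n = n} (λ i → ns i , 1) ×
                 ∀ i → WithDenominator d (∑ λ j → Γ j i) (ns i)
aggregate-tabulate {k} {n} {x} {Γ} reps =
  let d , ns , 0<d , ns≡ , ns-share = common
  in  d , ns , 0<d , trans (cong natural* (trans columns≡ ns≡)) (List.map-tabulate ns (_, 1)) , ns-share
  where
  natural* : List ℕ → List Fraction
  natural* = List.map (_, 1)

  sums : Vector Fraction n
  sums i = sumFractions (tabulate λ j → x j i)

  common : ∃[ d ] ∃[ ns ] 0 < d × reverse (proj₂ (commonDenominator (tabulate sums))) ≡ tabulate {n = n} ns ×
                 ∀ i → WithDenominator d (∑ λ j → Γ j i) (ns i)
  common = commonDenominator-tabulate λ i → sumFractions-represents λ j → reps j i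

  columns≡ : reverse (proj₂ (commonDenominator (columnSums (rows x)))) ≡ reverse (proj₂ (commonDenominator (tabulate sums)))
  columns≡ = cong (λ xs → reverse (proj₂ (commonDenominator xs))) (columnSums-tabulate x)

-- Bounds on the OWA criterion

sum-mono : {f g : Vector ℚ n} → (∀ i → f i ℚ.≤ g i) → ∑ f ℚ.≤ ∑ g
sum-mono {zero}  f≤g = ℚ.≤-refl
sum-mono {suc n} f≤g = ℚ.+-mono-≤ (f≤g zero) (sum-mono (f≤g ∘ suc))

sum-nonNegative : {f : Vector ℚ n} → NonNegative f → 0ℚ ℚ.≤ ∑ f
sum-nonNegative {n} {f} f≥0 = subst (ℚ._≤ ∑ f) (sum-replicate-zero n) (sum-mono f≥0)

F-nonNegative : (X : Subset n) {c : Vector ℚ n} → NonNegative c → 0ℚ ℚ.≤ F X c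
F-nonNegative X {c} c≥0 = sum-nonNegative λ i → summand (lookup X i) (c≥0 i)
  where
  summand : ∀ b {q} → 0ℚ ℚ.≤ q → 0ℚ ℚ.≤ (if b then q else 0ℚ)
  summand true  q≥0 = q≥0
  summand false _   = ℚ.≤-refl

total : Vector (Vector ℚ n) k → Subset n → ℚ
total Γ X = ∑ λ j → F X (Γ j)

-- Interchanges the sums over elements and over scenarios; an element outside `X` contributes 0 on
-- either side.
F-scaled-sum : (X : Subset n) (Γ : Vector (Vector ℚ n) k) (m : ℚ) →
               F X (λ i → (∑ λ j → Γ j i) ℚ.* m) ≡ total Γ X ℚ.* m
F-scaled-sum X Γ m = begin
  ∑ (λ i → if lookup X i then (∑ λ j → Γ j i) ℚ.* m else 0ℚ)       ≡⟨ sum-cong-≗ (λ i → pull (lookup X i) (λ j → Γ j i)) ⟩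
  ∑ (λ i → (∑ λ j → if lookup X i then Γ j i else 0ℚ) ℚ.* m)       ≡⟨ *-distribʳ-sum m (λ i → ∑ λ j → if lookup X i then Γ j i else 0ℚ) ⟨
  ∑ (λ i → ∑ λ j → if lookup X i then Γ j i else 0ℚ) ℚ.* m         ≡⟨ cong (ℚ._* m) (∑-comm λ i j → if lookup X i then Γ j i else 0ℚ) ⟩
  ∑ (λ j → F X (Γ j)) ℚ.* m                                        ∎
  where
  open ≡-Reasoning
  pull : ∀ {k} b (g : Vector ℚ k) → (if b then ∑ g ℚ.* m else 0ℚ) ≡ (∑ λ j → if b then g j else 0ℚ) ℚ.* m
  pull     true  g = refl
  pull {k} false g = sym (trans (cong (ℚ._* m) (sum-replicate-zero k)) (ℚ.*-zeroˡ m))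

-- This is `(p - q) * (r - s) ≥ 0`, expanded.
rearrangement : ∀ {p q r s} → q ℚ.≤ p → s ℚ.≤ r → p ℚ.* s ℚ.+ q ℚ.* r ℚ.≤ p ℚ.* r ℚ.+ q ℚ.* s
rearrangement {p} {q} {r} {s} q≤p s≤r = begin
  p ℚ.* s ℚ.+ q ℚ.* r                                   ≡⟨ solve 4 (λ p q r s → p :* s :+ q :* r := (p :- q) :* s :+ (q :* r :+ q :* s)) refl p q r s ⟩
  (p ℚ.- q) ℚ.* s ℚ.+ (q ℚ.* r ℚ.+ q ℚ.* s)             ≤⟨ ℚ.+-monoˡ-≤ _ (ℚ.*-monoˡ-≤-nonNeg (p ℚ.- q) {{ℚ.nonNegative p-q≥0}} s≤r) ⟩
  (p ℚ.- q) ℚ.* r ℚ.+ (q ℚ.* r ℚ.+ q ℚ.* s)             ≡⟨ solve 4 (λ p q r s → (p :- q) :* r :+ (q :* r :+ q :* s) := p :* r :+ q :* s) refl p q r s ⟩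
  p ℚ.* r ℚ.+ q ℚ.* s                                   ∎
  where
  open ℚ.≤-Reasoning
  p-q≥0 : 0ℚ ℚ.≤ p ℚ.- q
  p-q≥0 = subst (ℚ._≤ p ℚ.- q) (ℚ.+-inverseʳ q) (ℚ.+-monoˡ-≤ (ℚ.- q) q≤p)

dot : Vector ℚ n → Vector ℚ n → ℚ
dot f g = ∑ λ i → f i ℚ.* g i

-- The sum over `i` of `rearrangement` for `p`, `f i`, `r`, `g i`. It bounds the cross terms in
-- `chebyshev`, where `p` and `r` are the leading entries.
dot-rearrangement : ∀ {p r} {f g : Vector ℚ n} → (∀ i → f i ℚ.≤ p) → (∀ i → g i ℚ.≤ r) →
                    p ℚ.* ∑ g ℚ.+ ∑ f ℚ.* r ℚ.≤ ι n ℚ.* (p ℚ.* r) ℚ.+ dot f g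
dot-rearrangement {zero}  {p} {r} f≤p g≤r = ℚ.≤-reflexive
  (solve 2 (λ p r → p :* :con 0ℚ :+ :con 0ℚ :* r := :con 0ℚ :* (p :* r) :+ :con 0ℚ) refl p r)
dot-rearrangement {suc n} {p} {r} {f} {g} f≤p g≤r = begin
  p ℚ.* (g₀ ℚ.+ G) ℚ.+ (f₀ ℚ.+ H) ℚ.* r                                ≡⟨ solve 6 (λ p r f g F G → p :* (g :+ G) :+ (f :+ F) :* r
                                                                            := (p :* g :+ f :* r) :+ (p :* G :+ F :* r)) refl p r f₀ g₀ H G ⟩
  (p ℚ.* g₀ ℚ.+ f₀ ℚ.* r) ℚ.+ (p ℚ.* G ℚ.+ H ℚ.* r)                    ≤⟨ ℚ.+-mono-≤ (rearrangement (f≤p zero) (g≤r zero))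
                                                                                      (dot-rearrangement (f≤p ∘ suc) (g≤r ∘ suc)) ⟩
  (p ℚ.* r ℚ.+ f₀ ℚ.* g₀) ℚ.+ (ι n ℚ.* (p ℚ.* r) ℚ.+ D)                ≡⟨ solve 4 (λ n pr fg D → (pr :+ fg) :+ (n :* pr :+ D)
                                                                            := (:con 1ℚ :+ n) :* pr :+ (fg :+ D)) refl (ι n) (p ℚ.* r) (f₀ ℚ.* g₀) D ⟩
  (ι 1 ℚ.+ ι n) ℚ.* (p ℚ.* r) ℚ.+ (f₀ ℚ.* g₀ ℚ.+ D)                    ≡⟨ cong (λ k → k ℚ.* (p ℚ.* r) ℚ.+ (f₀ ℚ.* g₀ ℚ.+ D)) (ι-+ 1 n) ⟨
  ι (suc n) ℚ.* (p ℚ.* r) ℚ.+ (f₀ ℚ.* g₀ ℚ.+ D)                        ∎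
  where
  open ℚ.≤-Reasoning
  f₀ = f zero
  g₀ = g zero
  H  = ∑ (tail f)
  G  = ∑ (tail g)
  D  = dot (tail f) (tail g)

-- Induction on the length. Splitting off the leading entries leaves `f₀ * g₀`, cross terms at most
-- `n * (f₀ * g₀) + D`, and a product of tail sums at most `n * D`; together these are
-- `(1 + n) * (f₀ * g₀ + D)`.
chebyshev : {f g : Vector ℚ n} → Nonincreasing f → Nonincreasing g → ∑ f ℚ.* ∑ g ℚ.≤ ι n ℚ.* dot f g
chebyshev {zero}          f↘ g↘ = ℚ.≤-refl
chebyshev {suc n} {f} {g} f↘ g↘ = begin
  (f₀ ℚ.+ H) ℚ.* (g₀ ℚ.+ G)                                                ≡⟨ solve 4 (λ f g F G → (f :+ F) :* (g :+ G)
                                                                                := f :* g :+ (f :* G :+ F :* g) :+ F :* G) refl f₀ g₀ H G ⟩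
  f₀ ℚ.* g₀ ℚ.+ (f₀ ℚ.* G ℚ.+ H ℚ.* g₀) ℚ.+ H ℚ.* G                        ≤⟨ ℚ.+-mono-≤ (ℚ.+-monoʳ-≤ (f₀ ℚ.* g₀)
                                                                                (dot-rearrangement (λ i → f↘ {zero} {suc i} z≤n) (λ i → g↘ {zero} {suc i} z≤n)))
                                                                                (chebyshev (λ i≤j → f↘ (s≤s i≤j)) (λ i≤j → g↘ (s≤s i≤j))) ⟩
  f₀ ℚ.* g₀ ℚ.+ (ι n ℚ.* (f₀ ℚ.* g₀) ℚ.+ D) ℚ.+ ι n ℚ.* D                  ≡⟨ solve 3 (λ n fg D → fg :+ (n :* fg :+ D) :+ n :* D
                                                                                := (:con 1ℚ :+ n) :* (fg :+ D)) refl (ι n) (f₀ ℚ.* g₀) D ⟩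
  (ι 1 ℚ.+ ι n) ℚ.* (f₀ ℚ.* g₀ ℚ.+ D)                                      ≡⟨ cong (ℚ._* (f₀ ℚ.* g₀ ℚ.+ D)) (ι-+ 1 n) ⟨
  ι (suc n) ℚ.* (f₀ ℚ.* g₀ ℚ.+ D)                                          ∎
  where
  open ℚ.≤-Reasoning
  f₀ = f zero
  g₀ = g zero
  H  = ∑ (tail f)
  G  = ∑ (tail g)
  D  = dot (tail f) (tail g)

module _ (w : Vector ℚ (suc k)) (w↘ : Nonincreasing w) (Γ : Vector (Vector ℚ n) (suc k)) (X : Subset n) where
  private
    σ = proj₁ (sortingPermutation λ j → F X (Γ j))

    sorted : Vector ℚ (suc k)
    sorted j = F X (Γ (σ ⟨$⟩ʳ j))

    sum-sorted : total Γ X ≡ ∑ sorted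
    sum-sorted = sum-permute (λ j → F X (Γ j)) σ

  OWA≤w₁*total : (∀ j → NonNegative (Γ j)) → OWA w Γ X ℚ.≤ head w ℚ.* total Γ X
  OWA≤w₁*total Γ≥0 = begin
    OWA w Γ X                                ≤⟨ sum-mono (λ j → ℚ.*-monoʳ-≤-nonNeg (sorted j)
                                                  {{ℚ.nonNegative (F-nonNegative X (Γ≥0 (σ ⟨$⟩ʳ j)))}} (w↘ {zero} {j} z≤n)) ⟩
    ∑ (λ j → head w ℚ.* sorted j)            ≡⟨ *-distribˡ-sum (head w) sorted ⟨
    head w ℚ.* ∑ sorted                      ≡⟨ cong (head w ℚ.*_) sum-sorted ⟨
    head w ℚ.* total Γ X                       ∎
    where open ℚ.≤-Reasoning

  total≤K*OWA : ∑ w ≡ 1ℚ → total Γ X ℚ.≤ ι (suc k) ℚ.* OWA w Γ X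
  total≤K*OWA ∑w≡1 = begin
    total Γ X                       ≡⟨ sum-sorted ⟩
    ∑ sorted                      ≡⟨ ℚ.*-identityˡ (∑ sorted) ⟨
    -- The factor 1 is the sum of the weights, so a product of two sums of nonincreasing vectors
    -- arises.
    1ℚ ℚ.* ∑ sorted               ≡⟨ cong (ℚ._* ∑ sorted) ∑w≡1 ⟨
    ∑ w ℚ.* ∑ sorted              ≤⟨ chebyshev w↘ (proj₂ (sortingPermutation λ j → F X (Γ j))) ⟩
    ι (suc k) ℚ.* OWA w Γ X       ∎
    where open ℚ.≤-Reasoning

-- The approximation algorithm

-- For `m ≥ 1` the base `suc m` is at most `2 * m`, and the factor `2 ^ k` goes into the constant.
polynomialTime-bound : ∀ p → ∃[ c ] ∃[ k ] ∀ m → 1 ≤ m → ⟦ p ⟧ m ≤ c * m ^ k + c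
polynomialTime-bound p with ⟦⟧≤power p
... | c , k , p≤ = c * 2 ^ k , k , λ m 1≤m → begin
  ⟦ p ⟧ m                              ≤⟨ p≤ m ⟩
  c * suc m ^ k                        ≤⟨ *-monoʳ-≤ c (^-monoˡ-≤ k (≤-trans (+-monoˡ-≤ m 1≤m) (+-monoʳ-≤ m (m≤m+n m 0)))) ⟩
  c * (2 * m) ^ k                      ≡⟨ cong (c *_) (^-distribʳ-* 2 m k) ⟩
  c * (2 ^ k * m ^ k)                  ≡⟨ *-assoc c (2 ^ k) (m ^ k) ⟨
  c * 2 ^ k * m ^ k                    ≤⟨ m≤m+n _ _ ⟩
  c * 2 ^ k * m ^ k + c * 2 ^ k        ∎
  where open ≤-Reasoning

encode-tabulate : ∀ {X : Set} (encode : X → Tree) (A : Code) {xs : Vector X n} {ys : Vector (Carrier A) n} →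
                  (∀ i → encode (xs i) ≡ Code.⌜ A ⌝ (ys i)) →
                  encodeVector encode xs ≡ Code.⌜ ListCode A ⌝ (tabulate ys)
encode-tabulate encode A {ys = ys} eq =
  cong encodeList (trans (List.tabulate-cong eq) (sym (List.map-tabulate ys Code.⌜ A ⌝)))

open Minimization
open OwaInstance

module _ (P : CombinatorialProblem) where
  private
    DescriptionCode WeightCode InputCode OutputCode : Code
    DescriptionCode = code (CombinatorialProblem.Description P) (CombinatorialProblem.encode P)
    WeightCode      = code Tree id
    InputCode       = DescriptionCode ⊗ MatrixCode ⊗ WeightCode
    OutputCode      = DescriptionCode ⊗ ListCode FractionCode

  -- Kept abstract because unfolding its time bound is prohibitively slow.
  abstract
    aggregateInput : Computable InputCode OutputCode (λ (D , rows , _) → D , aggregate rows)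
    aggregateInput = ⟨ fst , aggregateᶜ ∘ᶜ fst ∘ᶜ snd ⟩

  module _ (I : OwaInstance P) where
    private
      E = CombinatorialProblem.∣_∣ᴱ P (description I)

      fractions : Fin (K I) → Fin E → Fraction
      fractions j i = fraction (Γ I j i)

      aggregated : ∃[ d ] ∃[ ns ] 0 < d × aggregate (rows fractions) ≡ tabulate {n = E} (λ i → ns i , 1) ×
                                  ∀ i → WithDenominator d (∑ λ j → Γ I j i) (ns i)
      aggregated = aggregate-tabulate {x = fractions} {Γ = Γ I} λ j i → fraction-represents (Γ I j i) (Γ≥0 I j i)

      d : ℕ
      d = proj₁ aggregated

      ns : Vector ℕ E
      ns = proj₁ (proj₂ aggregated)

      input : Carrier InputCode
      input = description I , rows fractions , encodeVector encodeℚ (w I)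

    aggregatedCosts : CostInstance P
    aggregatedCosts = record { description = description I ; cost = ι ∘ ns ; cost≥0 = ι≥0 ∘ ns }

    private
      -- For nonnegative costs the sign part of the code is always `nil`, so the instance already is
      -- a matrix of fractions.
      encode-input : encode (MinOwa P) I ≡ Code.⌜ InputCode ⌝ input
      encode-input = cong (λ Γ → CombinatorialProblem.encode P (description I) ∙ Γ ∙ encodeVector encodeℚ (w I))
        (encode-tabulate (encodeVector encodeℚ) (ListCode FractionCode) {Γ I} λ j →
          encode-tabulate encodeℚ FractionCode {Γ I j} {fractions j} λ i → encode-fraction (Γ I j i) (Γ≥0 I j i))

      encode-output : encode (Min P) aggregatedCosts ≡ Code.⌜ OutputCode ⌝ (description I , aggregate (rows fractions))
      encode-output = cong (CombinatorialProblem.encode P (description I) ∙_) (begin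
        encodeVector encodeℚ (ι ∘ ns)                                      ≡⟨ encode-tabulate encodeℚ FractionCode {ι ∘ ns} (λ i → encode-ι (ns i)) ⟩
        Code.⌜ ListCode FractionCode ⌝ (tabulate λ i → ns i , 1)           ≡⟨ cong Code.⌜ ListCode FractionCode ⌝ (proj₁ (proj₂ (proj₂ (proj₂ aggregated)))) ⟨
        Code.⌜ ListCode FractionCode ⌝ (aggregate (rows fractions))        ∎)
        where open ≡-Reasoning

    aggregatedCosts-halts : ∃[ t ] program aggregateInput ⊢ encode (MinOwa P) I ⇓ encode (Min P) aggregatedCosts ⟨ t ⟩ ×
                                   t ≤ ⟦ bound aggregateInput ⟧ (size (encode (MinOwa P) I))
    aggregatedCosts-halts = subst₂
      (λ x y → ∃[ t ] program aggregateInput ⊢ x ⇓ y ⟨ t ⟩ × t ≤ ⟦ bound aggregateInput ⟧ (size x))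
      (sym encode-input) (sym encode-output) (halts aggregateInput input)

    total-scaled : ∀ X → F X (ι ∘ ns) ≡ total (Γ I) X ℚ.* ι d
    total-scaled X = trans
      (sum-cong-≗ λ i → cong (λ q → if lookup X i then q else 0ℚ) (WithDenominator.ratio (proj₂ (proj₂ (proj₂ (proj₂ aggregated))) i)))
      (F-scaled-sum X (Γ I) (ι d))

    optimal⇒approximate : NonincreasingWeights P I → ∀ {X} → Optimal (Min P) aggregatedCosts X →
                          WithinFactor (MinOwa P) (λ I → w₁ I ℚ.* Kℚ I) I X
    optimal⇒approximate w↘ {X} (feasible , minimal) = feasible , λ Y (feasibleY , _) → begin
      OWA (w I) (Γ I) X                            ≤⟨ OWA≤w₁*total (w I) w↘ (Γ I) X (Γ≥0 I) ⟩
      w₁ I ℚ.* total (Γ I) X                       ≤⟨ ℚ.*-monoˡ-≤-nonNeg (w₁ I) (total≤ Y feasibleY) ⟩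
      w₁ I ℚ.* total (Γ I) Y                       ≤⟨ ℚ.*-monoˡ-≤-nonNeg (w₁ I) (total≤K*OWA (w I) w↘ (Γ I) Y (∑w≡1 I)) ⟩
      w₁ I ℚ.* (Kℚ I ℚ.* OWA (w I) (Γ I) Y)        ≡⟨ ℚ.*-assoc (w₁ I) (Kℚ I) _ ⟨
      w₁ I ℚ.* Kℚ I ℚ.* OWA (w I) (Γ I) Y          ∎
      where
      open ℚ.≤-Reasoning
      instance
        w₁≥0 : ℚ.NonNegative (w₁ I)
        w₁≥0 = ℚ.nonNegative (w≥0 I zero)

      total≤ : ∀ Y → CombinatorialProblem.Φ P (description I) Y → total (Γ I) X ℚ.≤ total (Γ I) Y
      -- Minimality is known for the total cost scaled by the common denominator `d`, which is
      -- positive and cancels.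
      total≤ Y feasibleY = ℚ.*-cancelʳ-≤-pos (ι d) {{ι>0 (proj₁ (proj₂ (proj₂ aggregated)))}}
        (subst₂ ℚ._≤_ (total-scaled X) (total-scaled Y) (minimal Y feasibleY))

corollary2 : (P : CombinatorialProblem) →
    PolynomiallySolvable (Min P) →
    ApproximableWithin (restrict (MinOwa P) (NonincreasingWeights P))
    (λ (I , _) → w₁ I ℚ.* Kℚ I)
corollary2 P (solver , c , k , solves) =
  (program reduction ⨾ solver) , proj₁ powerBound , proj₁ (proj₂ powerBound) , λ (I , w↘) →
    let X , optimal , u , solve , u≤  = solves (aggregatedCosts P I)
        t , reduce , t≤               = aggregatedCosts-halts P I
    in X , optimal⇒approximate P I w↘ optimal , t + u , ⇓seq reduce solve , (begin
      t + u                                                           ≤⟨ +-mono-≤ t≤ (≤-trans u≤ (≤-reflexive (sym (cong (_+ c) (⟦monomial⟧ c k _))))) ⟩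
      ⟦ bound reduction ⟧ (N I) + ⟦ solving ⟧ (size (encode (Min P) (aggregatedCosts P I)))
                                                                      ≤⟨ +-monoʳ-≤ (⟦ bound reduction ⟧ (N I)) (⟦⟧-mono solving (≤-trans (result≤time reduce) t≤)) ⟩
      ⟦ time ⟧ (N I)                                                  ≤⟨ proj₂ (proj₂ powerBound) (N I) (1≤size (encode (MinOwa P) I)) ⟩
      _                                                               ∎)
  where
  open ≤-Reasoning
  reduction = aggregateInput P
  solving   = monomial c k ⊕ con c
  -- The solver runs on the output of the reduction, whose size is at most the time of the
  -- reduction; hence the composition.
  time      = bound reduction ⊕ solving ∘ₚ bound reduction

  powerBound : ∃[ c ] ∃[ k ] ∀ m → 1 ≤ m → ⟦ time ⟧ m ≤ c * m ^ k + c
  powerBound = polynomialTime-bound time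

  N : OwaInstance P → ℕ
  N I = size (encode (MinOwa P) I)
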